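{- Let $P\subset\mathbb{R}^d$ be a polytope and $\eta$ a normalization. There is a polytope $\Gamma^{\eta}_{P}\subset\mathbb{R}^d$, called the neighbotope of $P$ and $\eta$, such that the following holds: for any generic objective functions $c,c'\in\mathbb{R}^d$ $$\mathcal{B}^\eta_P(c)=\mathcal{B}^\eta_P(c')\quad\Longleftrightarrow\quad(\Gamma^\eta_P)^{c}=(\Gamma^\eta_P)^{c'}.$$
   Context: For a polytope $P\subset\mathbb{R}^d$, $V(P)$ denotes its vertex set, $E(P)$ its edges, $G(P)=(V(P),E(P))$ its graph, and $\mathrm{Nb}_P(v)$ the set of vertices adjacent to $v$. A normalization is a function $\eta:\mathbb{R}^d\to\mathbb{R}$ (such that the quotients below are defined). An objective function $c\in\mathbb{R}^d$ is generic if $c^tu\neq c^tv$ for all edges $uv$ (so there is a unique maximizing vertex $v_{opt}$) and the maxima below are uniquely attained. For generic $c$, $\mathcal{B}^\eta_P(c):V(P)\to V(P)$ is the arborescence obtained from the normalized-weight pivot rule with normalization $\eta$ (independent of $c$) and weight $c$: it fixes $v_{opt}$ and sends each $v\neq v_{opt}$ to $$\operatorname{argmax}\left\{\frac{c^t(u-v)}{\eta(u-v)} : u\in\mathrm{Nb}_P(v),\ c^tu>c^tv\right\}.$$ The neighbotope is defined as follows. An arborescence on the undirected graph $G(P)$ is a map $\mathcal{B}:V(P)\to V(P)$ such that there is a unique vertex $r$ with $\mathcal{B}(r)=r$, $\mathcal{B}(v)\in\mathrm{Nb}_P(v)$ for all $v\ne r$, and for every $v$ there is $k\ge1$ with $\mathcal{B}^k(v)=r$.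 Put $\psi^\eta(\mathcal{B})=\sum_{v\in V(P)}\frac{\mathcal{B}(v)-v}{\eta(\mathcal{B}(v)-v)}$ with the convention $\frac{0}{\eta(0)}=0$. Then $$\Gamma^\eta_P=\operatorname{conv}\{\psi^\eta(\mathcal{B}) : \mathcal{B}\text{ an arborescence of }G(P)\}.$$ For a polytope $Q\subset\mathbb{R}^d$ and $c\in\mathbb{R}^d$, $Q^c$ is the face of $Q$ on which $x\mapsto c^tx$ is maximal.
   Formalization: The normalization η is required to be positive on the edge directions u−v of P; with negative values allowed the claim fails, e.g. for the triangle (0,0),(1,0),(0,1), η = −1, c = (1,2), c' = (2,1). -}

module Defs where

open import Algebra.Bundles using (CommutativeRing)
open import Algebra.Structures using (IsCommutativeRing)
open import Axiom.ExcludedMiddle using (ExcludedMiddle)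
open import Data.Fin.Base using (Fin)
open import Data.List.Base using (List; length; lookup; filter; deduplicate)
import Data.List.Membership.Setoid as SetoidMembership
import Data.List.Membership.Setoid.Properties as SetoidMembershipₚ
open import Data.List.Relation.Unary.Unique.DecSetoid.Properties using (deduplicate-!)
import Data.List.Relation.Unary.Unique.Setoid as SetoidUnique
open import Data.Nat.Base using (ℕ)
import Data.Nat.Base as ℕ
open import Data.Product.Base using (Σ-syntax; ∃; ∃-syntax; _×_; _,_; proj₁; proj₂)
open import Data.Product using (∃!)
open import Data.Sum.Base using (_⊎_; inj₁; inj₂)
open import Data.Vec.Functional using (Vector)
import Data.Vec.Functional.Relation.Binary.Equality.Setoid as VectorEquality
open import Function.Bundles using (_⇔_; mk⇔)
open import Function.Definitions using (Congruent)
import Function.Endo.Propositional as Endo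
open import Level using (0ℓ)
open import Relation.Binary.Bundles using (Setoid; TotalOrder; DecSetoid)
open import Relation.Binary.Core using (Rel)
import Relation.Binary.Construct.NonStrictToStrict as ToStrict
open import Relation.Binary.PropositionalEquality.Core using (_≡_; _≢_)
open import Relation.Binary.Structures using (IsTotalOrder)
open import Relation.Nullary using (¬_; yes; no; contradiction)
open import Relation.Unary using (Pred; _∈_; _≐_)

-- The real numbers, characterised (up to unique isomorphism) as a Dedekind
-- complete ordered field.  As usual for a total inverse, 0# ⁻¹ is unspecified.
record Reals : Set₁ where
  infix  4 _≈_ _≤_
  infixl 6 _+_
  infixl 7 _*_
  infix  8 -_ _⁻¹
  field
    Carrier : Set
    _≈_ _≤_ : Rel Carrier 0ℓ
    _+_ _*_ : Carrier → Carrier → Carrier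
    -_ _⁻¹  : Carrier → Carrier
    0# 1#   : Carrier

    isCommutativeRing : IsCommutativeRing _≈_ _+_ _*_ -_ 0# 1#
    0≉1               : ¬ 0# ≈ 1#
    ⁻¹-cong           : Congruent _≈_ _≈_ _⁻¹
    ⁻¹-inverseʳ       : ∀ x → ¬ x ≈ 0# → x * x ⁻¹ ≈ 1#

    isTotalOrder : IsTotalOrder _≈_ _≤_
    +-monoʳ-≤    : ∀ z {x y} → x ≤ y → z + x ≤ z + y
    *-nonNeg     : ∀ {x y} → 0# ≤ x → 0# ≤ y → 0# ≤ x * y

  UpperBound : Pred Carrier 0ℓ → Pred Carrier 0ℓ
  UpperBound S b = ∀ x → x ∈ S → x ≤ b

  field
    complete : ∀ (S : Pred Carrier 0ℓ) → ∃ S → ∃ (UpperBound S) →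
               ∃[ s ] UpperBound S s × (∀ b → UpperBound S b → s ≤ b)

  commutativeRing : CommutativeRing 0ℓ 0ℓ
  commutativeRing = record { isCommutativeRing = isCommutativeRing }

  totalOrder : TotalOrder 0ℓ 0ℓ 0ℓ
  totalOrder = record { isTotalOrder = isTotalOrder }

  open CommutativeRing commutativeRing public using (_-_)
  open ToStrict _≈_ _≤_ public using (_<_)

  infixl 7 _/_
  _/_ : Carrier → Carrier → Carrier
  x / y = x * y ⁻¹

module Polytopes (em : ExcludedMiddle 0ℓ) (ℝ : Reals) where

  open Reals ℝ public
  open CommutativeRing commutativeRing using (setoid; semiring)
  open import Algebra.Properties.Semiring.Sum semiring public using (sum)
  open VectorEquality setoid public using (_≋_; ≋-setoid)

  infixl 6 _-ᵥ_
  infixl 7 _∙_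
  infix  4 _∈ₗ_

  ℝ^_ : ℕ → Set
  ℝ^ d = Vector Carrier d

  _-ᵥ_ : ∀ {d} → ℝ^ d → ℝ^ d → ℝ^ d
  (x -ᵥ y) i = x i - y i

  _∙_ : ∀ {d} → ℝ^ d → ℝ^ d → Carrier
  c ∙ x = sum λ i → c i * x i

  _∈ₗ_ : ∀ {d} → ℝ^ d → List (ℝ^ d) → Set
  _∈ₗ_ {d} = SetoidMembership._∈_ (≋-setoid d)

  Conv : ∀ {d} → Pred (ℝ^ d) 0ℓ → Pred (ℝ^ d) 0ℓ
  Conv {d} S x =
    Σ[ n ∈ ℕ ] Σ[ w ∈ Vector Carrier n ] Σ[ p ∈ Vector (ℝ^ d) n ]
      (∀ i → 0# ≤ w i) × sum w ≈ 1# × (∀ i → p i ∈ S) ×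
      x ≋ λ j → sum λ i → w i * p i j

  -- A polytope is presented by finitely many points spanning it, which may
  -- include redundant points and repetitions.
  record Polytope (d : ℕ) : Set where
    constructor hull
    field
      points : List (ℝ^ d)

  open Polytope public

  ⟦_⟧ : ∀ {d} → Polytope d → Pred (ℝ^ d) 0ℓ
  ⟦ P ⟧ = Conv (_∈ₗ points P)

  face : ∀ {d} → Pred (ℝ^ d) 0ℓ → ℝ^ d → Pred (ℝ^ d) 0ℓ
  face Q c x = x ∈ Q × (∀ y → y ∈ Q → c ∙ y ≤ c ∙ x)

  IsVertex : ∀ {d} → Pred (ℝ^ d) 0ℓ → Pred (ℝ^ d) 0ℓ
  IsVertex Q v = ∃[ c ] face Q c ≐ (_≋ v)

  -- The segment [u , v] is a one-dimensional face.
  IsEdge : ∀ {d} → Pred (ℝ^ d) 0ℓ → Rel (ℝ^ d) 0ℓ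
  IsEdge Q u v = ¬ u ≋ v × ∃[ c ] face Q c ≐ Conv (λ x → x ≋ u ⊎ x ≋ v)

  -- The vertex set, as a list without repetitions: every vertex is one of the
  -- spanning points (see ∈-vertices⇔ and vertices-unique below).
  vertices : ∀ {d} → Polytope d → List (ℝ^ d)
  vertices P = deduplicate {R = _≋_} (λ _ _ → em) (filter {P = IsVertex ⟦ P ⟧} (λ _ → em) (points P))

  module VertexProofs where
    open CommutativeRing commutativeRing
      hiding (zero; setoid; semiring; Carrier; _≈_; _+_; _*_; -_; 0#; 1#; _-_)
    open import Algebra.Properties.Semiring.Sum semiring
      using (sum-cong-≋; sum-replicate-zero; ∑-comm; ∑-distrib-+; *-distribˡ-sum; *-distribʳ-sum)
    open import Algebra.Properties.Ring ring using (-‿distribʳ-*)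
    open import Relation.Binary.Reasoning.Setoid setoid
    open TotalOrder totalOrder using (≤-respʳ-≈; ≤-respˡ-≈; antisym)
      renaming (refl to ≤-refl; trans to ≤-trans; reflexive to ≤-reflexive)
    open import Data.Fin.Base using (zero; suc)

    ∙-congʳ : ∀ {d} (c : ℝ^ d) {x y} → x ≋ y → c ∙ x ≈ c ∙ y
    ∙-congʳ c x≋y = sum-cong-≋ λ i → *-congˡ (x≋y i)

    ∙-sum : ∀ {d n} (c : ℝ^ d) (w : Vector Carrier n) (p : Vector (ℝ^ d) n) →
            c ∙ (λ j → sum λ i → w i * p i j) ≈ sum λ i → w i * (c ∙ p i)
    ∙-sum c w p = begin
      (sum λ j → c j * sum λ i → w i * p i j)    ≈⟨ sum-cong-≋ (λ j → *-distribˡ-sum (c j) λ i → w i * p i j) ⟩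
      (sum λ j → sum λ i → c j * (w i * p i j))  ≈⟨ ∑-comm (λ j i → c j * (w i * p i j)) ⟩
      (sum λ i → sum λ j → c j * (w i * p i j))  ≈⟨ sum-cong-≋ (λ i → sum-cong-≋ λ j → swap (c j) (w i) (p i j)) ⟩
      (sum λ i → sum λ j → w i * (c j * p i j))  ≈⟨ sum-cong-≋ (λ i → *-distribˡ-sum (w i) λ j → c j * p i j) ⟨
      (sum λ i → w i * (c ∙ p i))                ∎
      where
      swap : ∀ x y z → x * (y * z) ≈ y * (x * z)
      swap x y z = trans (sym (*-assoc x y z)) (trans (*-congʳ (*-comm x y)) (*-assoc y x z))

    sum-nonNeg : ∀ {n} (f : Vector Carrier n) → (∀ i → 0# ≤ f i) → 0# ≤ sum f
    sum-nonNeg {ℕ.zero}  f 0≤f = ≤-refl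
    sum-nonNeg {ℕ.suc n} f 0≤f =
      ≤-trans (≤-respʳ-≈ (sym (+-identityʳ _)) (0≤f zero))
              (+-monoʳ-≤ (f zero) (sum-nonNeg (λ i → f (suc i)) λ i → 0≤f (suc i)))

    sum≈0⇒≈0 : ∀ {n} (f : Vector Carrier n) → (∀ i → 0# ≤ f i) → sum f ≈ 0# → ∀ i → f i ≈ 0#
    sum≈0⇒≈0 {ℕ.suc n} f 0≤f Σ≈0 = λ where
        zero    → f₀≈0
        (suc i) → sum≈0⇒≈0 (λ i → f (suc i)) (λ i → 0≤f (suc i)) tail≈0 i
      where
      f₀≈0 : f zero ≈ 0#
      f₀≈0 = antisym (≤-respˡ-≈ (+-identityʳ _) (≤-respʳ-≈ Σ≈0
               (+-monoʳ-≤ (f zero) (sum-nonNeg _ λ i → 0≤f (suc i))))) (0≤f zero)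

      tail≈0 : (sum λ i → f (suc i)) ≈ 0#
      tail≈0 = trans (sym (+-identityˡ _)) (trans (+-congʳ (sym f₀≈0)) Σ≈0)

    ≤⇒0≤- : ∀ {x y} → x ≤ y → 0# ≤ y - x
    ≤⇒0≤- {x} {y} x≤y =
      ≤-respˡ-≈ (-‿inverseˡ x) (≤-respʳ-≈ (+-comm (- x) y) (+-monoʳ-≤ (- x) x≤y))

    -≈0⇒≈ : ∀ {x y} → y - x ≈ 0# → x ≈ y
    -≈0⇒≈ {x} {y} e = begin
      x              ≈⟨ +-identityˡ x ⟨
      0# + x         ≈⟨ +-congʳ e ⟨
      y - x + x      ≈⟨ +-assoc y (- x) x ⟩
      y + (- x + x)  ≈⟨ +-congˡ (-‿inverseˡ x) ⟩
      y + 0#         ≈⟨ +-identityʳ y ⟩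
      y              ∎

    *-cancel-0 : ∀ {x y} → ¬ x ≈ 0# → x * y ≈ 0# → y ≈ 0#
    *-cancel-0 {x} {y} x≉0 xy≈0 = begin
      y                ≈⟨ *-identityˡ y ⟨
      1# * y           ≈⟨ *-congʳ (trans (*-comm (x ⁻¹) x) (⁻¹-inverseʳ x x≉0)) ⟨
      x ⁻¹ * x * y     ≈⟨ *-assoc (x ⁻¹) x y ⟩
      x ⁻¹ * (x * y)   ≈⟨ *-congˡ xy≈0 ⟩
      x ⁻¹ * 0#        ≈⟨ zeroʳ (x ⁻¹) ⟩
      0#               ∎

    ∃≉0 : ∀ {n} (w : Vector Carrier n) → sum w ≈ 1# → ∃[ i ] ¬ w i ≈ 0#
    ∃≉0 {n} w Σw≈1 with em {∃[ i ] ¬ w i ≈ 0#}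
    ... | yes i∃ = i∃
    ... | no ¬∃  = contradiction
        (trans (sym (trans (sum-cong-≋ all≈0) (sum-replicate-zero n))) Σw≈1) 0≉1
      where
      all≈0 : ∀ i → w i ≈ 0#
      all≈0 i with em {w i ≈ 0#}
      ... | yes e = e
      ... | no ¬e = contradiction (i , ¬e) ¬∃

    points⊆hull : ∀ {d} (P : Polytope d) {x} → x ∈ₗ points P → x ∈ ⟦ P ⟧
    points⊆hull P {x} x∈P =
      1 , (λ _ → 1#) , (λ _ → x) , (λ _ → 0≤1) , +-identityʳ 1# , (λ _ → x∈P) ,
      λ j → sym (trans (+-identityʳ _) (*-identityˡ (x j)))
      where
      0≤1 : 0# ≤ 1#
      0≤1 with IsTotalOrder.total isTotalOrder 0# 1#
      ... | inj₁ 0≤1 = 0≤1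
      ... | inj₂ 1≤0 = ≤-respʳ-≈ -1*-1≈1 (*-nonNeg 0≤-1 0≤-1)
        where
        0≤-1 : 0# ≤ - 1#
        0≤-1 = ≤-respʳ-≈ (+-identityˡ (- 1#)) (≤⇒0≤- 1≤0)
        -1*-1≈1 : - 1# * - 1# ≈ 1#
        -1*-1≈1 = begin
          - 1# * - 1#    ≈⟨ -‿distribʳ-* (- 1#) 1# ⟨
          - (- 1# * 1#)  ≈⟨ -‿cong (*-identityʳ (- 1#)) ⟩
          - - 1#         ≈⟨ ⁻¹-involutive 1# ⟩
          1#             ∎
          where open import Algebra.Properties.Group +-group using (⁻¹-involutive)

    module _ {d : ℕ} (P : Polytope d) where
      open Setoid (≋-setoid d) using () renaming (refl to ≋-refl; sym to ≋-sym; trans to ≋-trans)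

      IsVertex-resp : ∀ {x y} → x ≋ y → IsVertex ⟦ P ⟧ x → IsVertex ⟦ P ⟧ y
      IsVertex-resp x≋y (c , to , from) =
        c , (λ z∈ → ≋-trans (to z∈) x≋y) , (λ z≋y → from (≋-trans z≋y (≋-sym x≋y)))

      vertex∈points : ∀ {x} → IsVertex ⟦ P ⟧ x → x ∈ₗ points P
      vertex∈points {x} (c , to , from) with from ≋-refl
      ... | (n , w , p , 0≤w , Σw≈1 , p∈P , x≋) , max =
          SetoidMembershipₚ.∈-resp-≈ (≋-setoid d) pᵢ≋x (p∈P i)
        where
        gap : Vector Carrier n
        gap k = c ∙ x - c ∙ p k

        0≤gap : ∀ k → 0# ≤ gap k
        0≤gap k = ≤⇒0≤- (max (p k) (points⊆hull P (p∈P k)))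

        Σ+≈ : (sum λ k → w k * gap k) + c ∙ x ≈ c ∙ x
        Σ+≈ = begin
          (sum λ k → w k * gap k) + c ∙ x
            ≈⟨ +-congˡ (trans (∙-congʳ c x≋) (∙-sum c w p)) ⟩
          (sum λ k → w k * gap k) + (sum λ k → w k * (c ∙ p k))
            ≈⟨ ∑-distrib-+ (λ k → w k * gap k) (λ k → w k * (c ∙ p k)) ⟨
          (sum λ k → w k * gap k + w k * (c ∙ p k))
            ≈⟨ sum-cong-≋ (λ k → trans (sym (distribˡ (w k) _ _)) (*-congˡ (cancel (c ∙ x) (c ∙ p k)))) ⟩
          (sum λ k → w k * (c ∙ x))
            ≈⟨ *-distribʳ-sum (c ∙ x) w ⟨
          sum w * (c ∙ x)
            ≈⟨ *-congʳ Σw≈1 ⟩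
          1# * (c ∙ x)
            ≈⟨ *-identityˡ (c ∙ x) ⟩
          c ∙ x ∎
          where
          cancel : ∀ a b → a - b + b ≈ a
          cancel a b = trans (+-assoc a (- b) b) (trans (+-congˡ (-‿inverseˡ b)) (+-identityʳ a))

        Σ≈0 : (sum λ k → w k * gap k) ≈ 0#
        Σ≈0 = identityˡ-unique _ _ Σ+≈
          where open import Algebra.Properties.Group +-group using (identityˡ-unique)

        i : Fin n
        i = proj₁ (∃≉0 w Σw≈1)

        cpᵢ≈cx : c ∙ p i ≈ c ∙ x
        cpᵢ≈cx = -≈0⇒≈ (*-cancel-0 (proj₂ (∃≉0 w Σw≈1))
          (sum≈0⇒≈0 (λ k → w k * gap k) (λ k → *-nonNeg (0≤w k) (0≤gap k)) Σ≈0 i))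

        pᵢ≋x : p i ≋ x
        pᵢ≋x = to (points⊆hull P (p∈P i) , λ y y∈ → ≤-trans (max y y∈) (≤-reflexive (sym cpᵢ≈cx)))

      decSetoid : DecSetoid 0ℓ 0ℓ
      decSetoid = record
        { Carrier          = ℝ^ d
        ; _≈_              = _≋_
        ; isDecEquivalence = record
          { isEquivalence = Setoid.isEquivalence (≋-setoid d)
          ; _≟_           = λ _ _ → em
          }
        }

      ∈-vertices⇔ : ∀ {x} → x ∈ₗ vertices P ⇔ IsVertex ⟦ P ⟧ x
      ∈-vertices⇔ = mk⇔
        (λ x∈ → proj₂ (SetoidMembershipₚ.∈-filter⁻ (≋-setoid d) (λ _ → em) IsVertex-resp {xs = points P}
          (SetoidMembershipₚ.∈-deduplicate⁻ (≋-setoid d) (λ _ _ → em) _ x∈)))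
        (λ v → SetoidMembershipₚ.∈-deduplicate⁺ (≋-setoid d) (λ _ _ → em) (λ e e′ → ≋-trans e′ (≋-sym e))
          (SetoidMembershipₚ.∈-filter⁺ (≋-setoid d) (λ _ → em) IsVertex-resp (vertex∈points v) v))

      vertices-unique : SetoidUnique.Unique (≋-setoid d) (vertices P)
      vertices-unique = deduplicate-! decSetoid (filter {P = IsVertex ⟦ P ⟧} (λ _ → em) (points P))

  open VertexProofs public using (∈-vertices⇔; vertices-unique)

  V : ∀ {d} → Polytope d → Set
  V P = Fin (length (vertices P))

  module _ {d : ℕ} (P : Polytope d) where

    vertex : V P → ℝ^ d
    vertex = lookup (vertices P)

    Adjacent : Rel (V P) 0ℓ
    Adjacent u v = IsEdge ⟦ P ⟧ (vertex u) (vertex v)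

    -- The quotients that occur are by η (u − v) for edges uv.  Besides being
    -- nonzero, η must be positive there.  For example, take η = −1 on the
    -- triangle (0,0) , (1,0) , (0,1): the pivot maps of (1,2) and (2,1) differ,
    -- yet both select the same vertex of the neighbotope.
    record IsNormalization (η : ℝ^ d → Carrier) : Set where
      field
        cong     : Congruent _≋_ _≈_ η
        positive : ∀ u v → Adjacent u v → 0# < η (vertex u -ᵥ vertex v)

    record IsArborescence (B : V P → V P) : Set where
      open Endo (V P) using (_^_)
      field
        uniqueRoot : ∃! _≡_ λ r → B r ≡ r

      root : V P
      root = proj₁ uniqueRoot

      field
        adjacent : ∀ v → v ≢ root → Adjacent v (B v)
        reaches  : ∀ v → ∃[ k ] 1 ℕ.≤ k × (B ^ k) v ≡ root

    module _ (η : ℝ^ d → Carrier) where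

      -- The term of the root has numerator 0, hence is 0 whatever η 0 is.
      ψ : (V P → V P) → ℝ^ d
      ψ B j = sum λ v → let δ = vertex (B v) -ᵥ vertex v in δ j / η δ

      neighbotope : Pred (ℝ^ d) 0ℓ
      neighbotope = Conv λ x → ∃[ B ] IsArborescence B × x ≋ ψ B

      module _ (c : ℝ^ d) where

        -- For generic c exactly one vertex of a nonempty P, v_opt, is optimal.
        Optimal : Pred (V P) 0ℓ
        Optimal v = vertex v ∈ face ⟦ P ⟧ c

        Improving : V P → Pred (V P) 0ℓ
        Improving v u = Adjacent v u × c ∙ vertex v < c ∙ vertex u

        slope : V P → V P → Carrier
        slope v u = let δ = vertex u -ᵥ vertex v in (c ∙ δ) / η δ

        IsArgmax : V P → Pred (V P) 0ℓ
        IsArgmax v u = Improving v u × (∀ u′ → Improving v u′ → slope v u′ ≤ slope v u)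

        record Generic : Set where
          field
            edges  : ∀ u v → Adjacent u v → ¬ c ∙ vertex u ≈ c ∙ vertex v
            argmax : ∀ v → ¬ Optimal v → ∃! _≡_ (IsArgmax v)

        pivot : Generic → V P → V P
        pivot g v with em {Optimal v}
        ... | yes _   = v
        ... | no ¬opt = proj₁ (Generic.argmax g v ¬opt)

{-# OPTIONS --safe #-}
module Submission where

-- By linearity, c ∙ ψ(B) is the sum over v of the c-slope of the step from v
-- to B(v).  The pivot map of a generic c takes at every v the strictly best
-- step: the unique steepest improving edge where one exists, and no step at
-- the optimum, where all edges have negative slope.  Hence ψ(pivot c) is the
-- unique c-maximal point of Γ, and it is attained by no other arborescence.
--
-- That the pivot map is an arborescence needs the optimum to be unique, although
-- genericity only speaks about edges: if the c-maximal face has a vertex x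
-- and a further point, then it contains an edge of P at x, on which c is constant.

open import Algebra.Bundles using (CommutativeRing)
open import Axiom.ExcludedMiddle using (ExcludedMiddle)
open import Data.Fin.Base using (Fin; zero; suc; finToFun; funToFin)
open import Data.Fin.Induction using (spo-noetherian)
open import Data.Fin.Properties using (finToFun-funToFin)
open import Data.List.Base using (length; lookup; map; filter; allFin)
open import Data.List.Membership.Propositional.Properties using (∈-allFin)
import Data.List.Membership.Setoid.Properties as Membership
import Data.List.Relation.Unary.All.Properties as All
open import Data.List.Relation.Unary.AllPairs.Core using (_∷_)
import Data.List.Relation.Unary.Any as Any
import Data.List.Relation.Unary.Any.Properties as Any
open import Data.List.Relation.Unary.Unique.Setoid using (Unique)
import Data.Nat.Base as ℕ
open import Data.Nat.Base using (ℕ)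
open import Data.Product.Base using (Σ-syntax; ∃; ∃-syntax; _×_; _,_; proj₁; proj₂)
open import Data.Sum.Base using (_⊎_; inj₁; inj₂; swap)
open import Data.Unit.Base using (⊤; tt)
open import Function.Base using (flip; _on_)
open import Function.Bundles using (_⇔_; mk⇔; Equivalence)
import Function.Endo.Propositional as Endo
open import Induction.WellFounded using (WellFounded; Acc; acc)
open import Level using (0ℓ)
open import Relation.Binary.Bundles using (Setoid; TotalOrder)
import Relation.Binary.Construct.On as On
open import Relation.Binary.PropositionalEquality as ≡ using (_≡_; _≢_; _≗_; refl; cong)
open import Relation.Nullary using (Dec; ¬_; yes; no; contradiction)
open import Relation.Unary using (Pred; _∈_; _≐_)
open import Defs

-- Arithmetic in an ordered field and maxima over finite index sets.

module OrderedField (em : ExcludedMiddle 0ℓ) (ℝ : Reals) where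
  open Polytopes em ℝ
  open Polytopes.VertexProofs em ℝ using (≤⇒0≤-; -≈0⇒≈; *-cancel-0)
  open CommutativeRing commutativeRing public
    hiding (zero; Carrier; _≈_; _+_; _*_; -_; 0#; 1#; _-_)
    renaming (refl to ≈-refl; sym to ≈-sym; trans to ≈-trans)
  open TotalOrder totalOrder public using (≤-respʳ-≈; ≤-respˡ-≈; antisym; total; poset)
    renaming (refl to ≤-refl; trans to ≤-trans; reflexive to ≤-reflexive)
  open import Algebra.Properties.Ring ring public using (-1*x≈-x; -‿distribʳ-*; -‿distribˡ-*)
  open import Algebra.Properties.Group +-group public
    using (//-rightDividesˡ) renaming (∙-cancelˡ to +-cancelˡ; ∙-cancelʳ to +-cancelʳ)
  import Relation.Binary.Construct.NonStrictToStrict _≈_ _≤_ as Strict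
  open import Relation.Binary.Reasoning.PartialOrder poset
  open import Algebra.Solver.Ring.NaturalCoefficients.Default commutativeSemiring public
    using (solve; _:=_; _:+_; _:*_; con)

  +-monoˡ-≤ : ∀ z {x y} → x ≤ y → x + z ≤ y + z
  +-monoˡ-≤ z x≤y = ≤-respˡ-≈ (+-comm z _) (≤-respʳ-≈ (+-comm z _) (+-monoʳ-≤ z x≤y))

  +-mono-≤ : ∀ {w x y z} → w ≤ x → y ≤ z → w + y ≤ x + z
  +-mono-≤ w≤x y≤z = ≤-trans (+-monoˡ-≤ _ w≤x) (+-monoʳ-≤ _ y≤z)

  +-cancelʳ-≤ : ∀ z {x y} → x + z ≤ y + z → x ≤ y
  +-cancelʳ-≤ z x+z≤y+z = ≤-respˡ-≈ (cancel _) (≤-respʳ-≈ (cancel _) (+-monoˡ-≤ (- z) x+z≤y+z))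
    where
    cancel : ∀ x → x + z - z ≈ x
    cancel x = ≈-trans (+-assoc x z (- z)) (≈-trans (+-congˡ (-‿inverseʳ z)) (+-identityʳ x))

  ≰⇒> : ∀ {x y} → ¬ x ≤ y → y < x
  ≰⇒> {x} {y} x≰y with total x y
  ... | inj₁ x≤y = contradiction x≤y x≰y
  ... | inj₂ y≤x = y≤x , λ y≈x → x≰y (≤-reflexive (≈-sym y≈x))

  <⇒≱ : ∀ {x y} → x < y → ¬ y ≤ x
  <⇒≱ (x≤y , x≉y) y≤x = x≉y (antisym x≤y y≤x)

  *-monoˡ-≤ : ∀ {z x y} → 0# ≤ z → x ≤ y → z * x ≤ z * y
  *-monoˡ-≤ {z} {x} {y} 0≤z x≤y = begin
    z * x                ≈⟨ +-identityˡ _ ⟨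
    0# + z * x           ≤⟨ +-monoˡ-≤ _ (*-nonNeg 0≤z (≤⇒0≤- x≤y)) ⟩
    z * (y - x) + z * x  ≈⟨ distribˡ z (y - x) x ⟨
    z * (y - x + x)      ≈⟨ *-congˡ (//-rightDividesˡ x y) ⟩
    z * y                ∎

  *-cancelˡ-≤ : ∀ {z x y} → 0# < z → z * x ≤ z * y → x ≤ y
  *-cancelˡ-≤ {z} {x} {y} (0≤z , 0≉z) zx≤zy with total x y
  ... | inj₁ x≤y = x≤y
  ... | inj₂ y≤x = ≤-reflexive (-≈0⇒≈ (*-cancel-0 (λ z≈0 → 0≉z (≈-sym z≈0)) (begin-equality
    z * (y - x)          ≈⟨ distribˡ z y (- x) ⟩
    z * y + z * - x      ≈⟨ +-cong (antisym (*-monoˡ-≤ 0≤z y≤x) zx≤zy) (≈-sym (-‿distribʳ-* z x)) ⟩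
    z * x - z * x        ≈⟨ -‿inverseʳ _ ⟩
    0#                   ∎)))

  *-cancelˡ : ∀ {z x y} → 0# < z → z * x ≈ z * y → x ≈ y
  *-cancelˡ 0<z zx≈zy =
    antisym (*-cancelˡ-≤ 0<z (≤-reflexive zx≈zy)) (*-cancelˡ-≤ 0<z (≤-reflexive (≈-sym zx≈zy)))

  square-nonNeg : ∀ x → 0# ≤ x * x
  square-nonNeg x with total 0# x
  ... | inj₁ 0≤x = *-nonNeg 0≤x 0≤x
  ... | inj₂ x≤0 = ≤-respʳ-≈ (begin-equality
    - x * - x      ≈⟨ -‿distribˡ-* x (- x) ⟨
    - (x * - x)    ≈⟨ -‿cong (≈-sym (-‿distribʳ-* x x)) ⟩
    - - (x * x)    ≈⟨ ⁻¹-involutive (x * x) ⟩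
    x * x          ∎) (*-nonNeg 0≤-x 0≤-x)
    where
    open import Algebra.Properties.Group +-group using (⁻¹-involutive)
    0≤-x : 0# ≤ - x
    0≤-x = ≤-respʳ-≈ (+-identityˡ (- x)) (≤⇒0≤- x≤0)

  0<1 : 0# < 1#
  0<1 = ≤-respʳ-≈ (*-identityˡ 1#) (square-nonNeg 1#) , 0≉1

  ⁻¹-inverseˡ : ∀ {x} → 0# < x → x ⁻¹ * x ≈ 1#
  ⁻¹-inverseˡ {x} 0<x =
    ≈-trans (*-comm (x ⁻¹) x) (⁻¹-inverseʳ x λ x≈0 → proj₂ 0<x (≈-sym x≈0))

  ⁻¹-pos : ∀ {x} → 0# < x → 0# < x ⁻¹
  ⁻¹-pos {x} 0<x = ≰⇒> λ x⁻¹≤0 → <⇒≱ 0<1 (begin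
    1#          ≈⟨ ⁻¹-inverseʳ x (λ x≈0 → proj₂ 0<x (≈-sym x≈0)) ⟨
    x * x ⁻¹    ≤⟨ *-monoˡ-≤ (proj₁ 0<x) x⁻¹≤0 ⟩
    x * 0#      ≈⟨ zeroʳ x ⟩
    0#          ∎)

  x/y*y≈x : ∀ x {y} → 0# < y → x / y * y ≈ x
  x/y*y≈x x {y} 0<y = begin-equality
    x * y ⁻¹ * y    ≈⟨ *-assoc x (y ⁻¹) y ⟩
    x * (y ⁻¹ * y)  ≈⟨ *-congˡ (⁻¹-inverseˡ 0<y) ⟩
    x * 1#          ≈⟨ *-identityʳ x ⟩
    x               ∎

  <-+1 : ∀ x → x < x + 1#
  <-+1 x = ≰⇒> λ x+1≤x → <⇒≱ 0<1 (+-cancelʳ-≤ x (begin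
    1# + x  ≈⟨ +-comm 1# x ⟩
    x + 1#  ≤⟨ x+1≤x ⟩
    x       ≈⟨ +-identityˡ x ⟨
    0# + x  ∎))

  <-respʳ-≈ : ∀ {x y z} → y ≈ z → x < y → x < z
  <-respʳ-≈ = Strict.<-respʳ-≈ ≈-sym ≈-trans ≤-respʳ-≈

  <-respˡ-≈ : ∀ {x y z} → y ≈ z → y < x → z < x
  <-respˡ-≈ = Strict.<-respˡ-≈ ≈-trans ≤-respˡ-≈

  -- Climbing to ever larger values stops on a finite index set. This drives both the search for a
  -- maximum and the walk along the pivot map to the optimum.
  <-on-noetherian : ∀ {n} (f : Fin n → Carrier) → WellFounded (flip (_<_ on f))
  <-on-noetherian f = spo-noetherian (On.isStrictPartialOrder f
    (Strict.<-isStrictPartialOrder (TotalOrder.isPartialOrder totalOrder)))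

  abstract
    -- Noetherian induction: move to a strictly larger value in `S` as long as there is one.
    maximum : ∀ {n} (f : Fin n → Carrier) (S : Pred (Fin n) 0ℓ) → ∃ S →
              ∃[ m ] m ∈ S × (∀ i → i ∈ S → f i ≤ f m)
    maximum f S (i , i∈S) = climb i i∈S (<-on-noetherian f i)
      where
      climb : ∀ i → i ∈ S → Acc (flip (_<_ on f)) i → ∃[ m ] m ∈ S × (∀ i → i ∈ S → f i ≤ f m)
      climb i i∈S (acc rec) with em {∃[ j ] j ∈ S × f i < f j}
      ... | yes (j , j∈S , fi<fj) = climb j j∈S (rec fi<fj)
      ... | no ¬∃ = i , i∈S , max
        where
        max : ∀ j → j ∈ S → f j ≤ f i
        max j j∈S with em {f j ≤ f i}
        ... | yes fj≤fi = fj≤fi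
        ... | no  fj≰fi = contradiction (j , j∈S , ≰⇒> fj≰fi) ¬∃

  bounded : ∀ {n} (r : Fin n → Carrier) → ∃[ K ] ∀ i → r i < K
  bounded {ℕ.zero}  r = 0# , λ ()
  bounded {ℕ.suc n} r =
    let m , _ , max = maximum r (λ _ → ⊤) (zero , tt)
    in r m + 1# , λ i → begin-strict
         r i        ≤⟨ max i tt ⟩
         r m        <⟨ <-+1 (r m) ⟩
         r m + 1#   ∎

-- Inner products and vectors of maximal length.

module Convexity (em : ExcludedMiddle 0ℓ) (ℝ : Reals) where
  open Polytopes em ℝ
  open Polytopes.VertexProofs em ℝ
  open OrderedField em ℝ
  open import Algebra.Properties.Semiring.Sum semiring
    using (sum-cong-≋; sum-replicate-zero; ∑-distrib-+; *-distribˡ-sum; *-distribʳ-sum)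
  open import Relation.Binary.Reasoning.PartialOrder poset

  ∙-comm : ∀ {d} (x y : ℝ^ d) → x ∙ y ≈ y ∙ x
  ∙-comm x y = sum-cong-≋ λ j → *-comm (x j) (y j)

  ∙-+ : ∀ {d} (c x y : ℝ^ d) → c ∙ (λ j → x j + y j) ≈ c ∙ x + c ∙ y
  ∙-+ c x y = ≈-trans (sum-cong-≋ λ j → distribˡ (c j) (x j) (y j))
    (∑-distrib-+ (λ j → c j * x j) (λ j → c j * y j))

  ∙-* : ∀ {d} (c x : ℝ^ d) k → c ∙ (λ j → k * x j) ≈ k * (c ∙ x)
  ∙-* c x k = ≈-trans
    (sum-cong-≋ λ j → solve 3 (λ a b e → a :* (b :* e) := b :* (a :* e)) ≈-refl (c j) k (x j))
    (≈-sym (*-distribˡ-sum k λ j → c j * x j))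

  ∙-- : ∀ {d} (c x y : ℝ^ d) → c ∙ (x -ᵥ y) + c ∙ y ≈ c ∙ x
  ∙-- c x y = ≈-trans (≈-sym (∙-+ c (x -ᵥ y) y)) (∙-congʳ c λ j → //-rightDividesˡ (y j) (x j))

  ∙-combine : ∀ {d} k (c f x : ℝ^ d) → (λ j → k * c j + f j) ∙ x ≈ k * (c ∙ x) + f ∙ x
  ∙-combine k c f x = begin-equality
    (λ j → k * c j + f j) ∙ x            ≈⟨ ∙-comm _ x ⟩
    x ∙ (λ j → k * c j + f j)            ≈⟨ ∙-+ x (λ j → k * c j) f ⟩
    x ∙ (λ j → k * c j) + x ∙ f          ≈⟨ +-cong (∙-* x c k) (∙-comm x f) ⟩
    k * (x ∙ c) + f ∙ x                  ≈⟨ +-congʳ (*-congˡ (∙-comm x c)) ⟩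
    k * (c ∙ x) + f ∙ x                  ∎

  ∙-self-nonNeg : ∀ {d} (x : ℝ^ d) → 0# ≤ x ∙ x
  ∙-self-nonNeg x = sum-nonNeg _ λ j → square-nonNeg (x j)

  ∙-self≈0 : ∀ {d} (x : ℝ^ d) → x ∙ x ≈ 0# → ∀ j → x j ≈ 0#
  ∙-self≈0 x x∙x≈0 j with em {x j ≈ 0#}
  ... | yes xⱼ≈0 = xⱼ≈0
  ... | no  xⱼ≉0 = *-cancel-0 xⱼ≉0 (sum≈0⇒≈0 _ (λ j → square-nonNeg (x j)) x∙x≈0 j)

  -- The law of cosines with the cross terms moved to the left. Writing `g` as `(g -ᵥ e) + e` leaves
  -- an identity between sums of products, which the semiring solver can settle.
  parallelogram : ∀ {d} (g e : ℝ^ d) →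
                  (g -ᵥ e) ∙ (g -ᵥ e) + (g ∙ e + g ∙ e) ≈ g ∙ g + e ∙ e
  parallelogram g e = begin-equality
    x ∙ x + (g ∙ e + g ∙ e)                          ≈⟨ +-congˡ (+-cong ge≈ ge≈) ⟩
    x ∙ x + ((x ∙ e + e ∙ e) + (x ∙ e + e ∙ e))      ≈⟨ solve 3 (λ xx xe ee →
        xx :+ ((xe :+ ee) :+ (xe :+ ee)) := (xx :+ xe) :+ (xe :+ ee) :+ ee) ≈-refl (x ∙ x) (x ∙ e) (e ∙ e) ⟩
    (x ∙ x + x ∙ e) + (x ∙ e + e ∙ e) + e ∙ e        ≈⟨ +-congʳ gg≈ ⟨
    g ∙ g + e ∙ e                                    ∎
    where
    x : ℝ^ _
    x = g -ᵥ e
    g≈ : ∀ j → g j ≈ x j + e j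
    g≈ j = ≈-sym (//-rightDividesˡ (e j) (g j))
    ge≈ : g ∙ e ≈ x ∙ e + e ∙ e
    ge≈ = ≈-trans (∙-comm g e) (≈-trans (∙-congʳ e g≈) (≈-trans (∙-+ e x e) (+-congʳ (∙-comm e x))))
    gg≈ : g ∙ g ≈ (x ∙ x + x ∙ e) + (x ∙ e + e ∙ e)
    gg≈ = ≈-trans (∙-congʳ g g≈) (≈-trans (∙-+ g x e) (+-cong
      (≈-trans (∙-comm g x) (≈-trans (∙-congʳ x g≈) (∙-+ x x e))) ge≈))

  -- A form of Cauchy-Schwarz free of square roots: if `g ∙ g ≤ g ∙ e`, then nonnegativity of the
  -- square of `g -ᵥ e` gives `g ∙ e + g ∙ e ≤ g ∙ g + e ∙ e ≤ g ∙ g + g ∙ e`, and one `g ∙ e`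
  -- cancels.
  longest-∙ : ∀ {d} (g e : ℝ^ d) → e ∙ e ≤ g ∙ g → g ∙ e ≤ g ∙ g
  longest-∙ g e ee≤gg with total (g ∙ e) (g ∙ g)
  ... | inj₁ ge≤gg = ge≤gg
  ... | inj₂ gg≤ge = +-cancelʳ-≤ (g ∙ e) (begin
    g ∙ e + g ∙ e                                  ≈⟨ +-identityˡ _ ⟨
    0# + (g ∙ e + g ∙ e)                           ≤⟨ +-monoˡ-≤ _ (∙-self-nonNeg (g -ᵥ e)) ⟩
    (g -ᵥ e) ∙ (g -ᵥ e) + (g ∙ e + g ∙ e)          ≈⟨ parallelogram g e ⟩
    g ∙ g + e ∙ e                                  ≤⟨ +-monoʳ-≤ _ (≤-trans ee≤gg gg≤ge) ⟩
    g ∙ g + g ∙ e                                  ∎)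

  -- With equality, the law of cosines leaves no room for a positive square of `g -ᵥ e`.
  longest-∙-unique : ∀ {d} (g e : ℝ^ d) → e ∙ e ≤ g ∙ g → g ∙ e ≈ g ∙ g → e ≋ g
  longest-∙-unique g e ee≤gg ge≈gg j = -≈0⇒≈ (∙-self≈0 (g -ᵥ e) (antisym
    (+-cancelʳ-≤ (g ∙ g + g ∙ g) (begin
      (g -ᵥ e) ∙ (g -ᵥ e) + (g ∙ g + g ∙ g)        ≈⟨ +-congˡ (+-cong ge≈gg ge≈gg) ⟨
      (g -ᵥ e) ∙ (g -ᵥ e) + (g ∙ e + g ∙ e)        ≈⟨ parallelogram g e ⟩
      g ∙ g + e ∙ e                                ≤⟨ +-monoʳ-≤ _ ee≤gg ⟩
      g ∙ g + g ∙ g                                ≈⟨ +-identityˡ _ ⟨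
      0# + (g ∙ g + g ∙ g)                         ∎))
    (∙-self-nonNeg (g -ᵥ e))) j)

  weighted-mean-const : ∀ {n} (w : Fin n → Carrier) b → sum w ≈ 1# → sum (λ i → w i * b) ≈ b
  weighted-mean-const w b Σw≈1 = begin-equality
    sum (λ i → w i * b)  ≈⟨ *-distribʳ-sum b w ⟨
    sum w * b            ≈⟨ *-congʳ Σw≈1 ⟩
    1# * b               ≈⟨ *-identityˡ b ⟩
    b                    ∎

  -- Convex hulls and their faces.

  module _ {d : ℕ} {S : Pred (ℝ^ d) 0ℓ} where

    Conv-mono : {T : Pred (ℝ^ d) 0ℓ} → (∀ {p} → S p → T p) → ∀ {x} → Conv S x → Conv T x
    Conv-mono S⊆T (n , w , p , 0≤w , Σw≈1 , p∈S , x≋) = n , w , p , 0≤w , Σw≈1 , (λ i → S⊆T (p∈S i)) , x≋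

    singleton⊆Conv : ∀ {p} → S p → ∀ {x} → x ≋ p → Conv S x
    singleton⊆Conv {p} p∈S x≋p =
      1 , (λ _ → 1#) , (λ _ → p) , (λ _ → proj₁ 0<1) , +-identityʳ 1# , (λ _ → p∈S) ,
      λ j → ≈-trans (x≋p j) (≈-sym (≈-trans (+-identityʳ _) (*-identityˡ (p j))))

    Conv-nonempty : ∀ {x} → Conv S x → ∃ S
    Conv-nonempty (n , w , p , 0≤w , Σw≈1 , p∈S , x≋) = let i , _ = ∃≉0 w Σw≈1 in p i , p∈S i

    -- That is, m − h∙x is the w-weighted mean of the gaps m − h∙pᵢ.
    slack : (h : ℝ^ d) (m : Carrier) {x : ℝ^ d} ((n , w , p , _) : Conv S x) →
            sum (λ i → w i * (m - h ∙ p i)) + h ∙ x ≈ m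
    slack h m {x} (n , w , p , 0≤w , Σw≈1 , p∈S , x≋) = begin-equality
      sum (λ i → w i * (m - h ∙ p i)) + h ∙ x
        ≈⟨ +-congˡ (≈-trans (∙-congʳ h x≋) (∙-sum h w p)) ⟩
      sum (λ i → w i * (m - h ∙ p i)) + sum (λ i → w i * (h ∙ p i))
        ≈⟨ ∑-distrib-+ (λ i → w i * (m - h ∙ p i)) (λ i → w i * (h ∙ p i)) ⟨
      sum (λ i → w i * (m - h ∙ p i) + w i * (h ∙ p i))
        ≈⟨ sum-cong-≋ (λ i → ≈-trans (≈-sym (distribˡ (w i) _ _)) (*-congˡ (//-rightDividesˡ (h ∙ p i) m))) ⟩
      sum (λ i → w i * m)   ≈⟨ weighted-mean-const w m Σw≈1 ⟩
      m                     ∎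

    Conv-≤ : ∀ h {m} → (∀ {p} → S p → h ∙ p ≤ m) → ∀ {x} → Conv S x → h ∙ x ≤ m
    Conv-≤ h {m} S≤m {x} x∈@(n , w , p , 0≤w , Σw≈1 , p∈S , x≋) = begin
      h ∙ x                                      ≈⟨ +-identityˡ _ ⟨
      0# + h ∙ x                                 ≤⟨ +-monoˡ-≤ _ (sum-nonNeg _ λ i → *-nonNeg (0≤w i) (≤⇒0≤- (S≤m (p∈S i)))) ⟩
      sum (λ i → w i * (m - h ∙ p i)) + h ∙ x    ≈⟨ slack h m x∈ ⟩
      m                                          ∎

    Conv-≈ : ∀ h {m} → (∀ {p} → S p → h ∙ p ≈ m) → ∀ {x} → Conv S x → h ∙ x ≈ m
    Conv-≈ h {m} S≈m {x} x∈@(n , w , p , 0≤w , Σw≈1 , p∈S , x≋) = begin-equality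
      h ∙ x                                      ≈⟨ +-identityˡ _ ⟨
      0# + h ∙ x                                 ≈⟨ +-congʳ (≈-trans (sum-cong-≋ λ i →
        ≈-trans (*-congˡ (≈-trans (+-congˡ (-‿cong (S≈m (p∈S i)))) (-‿inverseʳ m))) (zeroʳ (w i))) (sum-replicate-zero n)) ⟨
      sum (λ i → w i * (m - h ∙ p i)) + h ∙ x    ≈⟨ slack h m x∈ ⟩
      m                                          ∎

  module _ {d : ℕ} {S : Pred (ℝ^ d) 0ℓ} where

    Top : (h q : ℝ^ d) → Pred (ℝ^ d) 0ℓ
    Top h q p = S p × h ∙ p ≈ h ∙ q

    -- Points off the supporting hyperplane carry zero weight, so they may be
    -- replaced by any point on it.
    face-Conv : ∀ h q → S q → (∀ {p} → S p → h ∙ p ≤ h ∙ q) →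
                face (Conv S) h ≐ Conv (Top h q)
    face-Conv h q q∈S S≤ = to , λ {x} x∈ →
        Conv-mono {S = Top h q} proj₁ x∈ ,
        λ y y∈ → ≤-trans (Conv-≤ h S≤ y∈) (≤-reflexive (≈-sym (Conv-≈ {S = Top h q} h proj₂ x∈)))
      where
      to : ∀ {x} → x ∈ face (Conv S) h → Conv (Top h q) x
      to {x} (x∈@(n , w , p , 0≤w , Σw≈1 , p∈S , x≋) , x-max) =
        n , w , (λ i → proj₁ (new i)) , 0≤w , Σw≈1 , (λ i → proj₁ (proj₂ (new i))) ,
        λ j → ≈-trans (x≋ j) (sum-cong-≋ λ i → proj₂ (proj₂ (new i)) j)
        where
        hx≈hq : h ∙ x ≈ h ∙ q
        hx≈hq = antisym (Conv-≤ h S≤ x∈) (x-max q (singleton⊆Conv q∈S λ _ → ≈-refl))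

        -- The point `x` has the full height `h ∙ q`, so the weighted mean of the gaps is zero. All
        -- its terms are nonnegative, so each of them vanishes.
        Σ≈0 : sum (λ i → w i * (h ∙ q - h ∙ p i)) ≈ 0#
        Σ≈0 = +-cancelʳ (h ∙ x) _ _ (≈-trans (slack {S = S} h (h ∙ q) x∈) (≈-trans (≈-sym hx≈hq) (≈-sym (+-identityˡ _))))

        term≈0 : ∀ i → w i * (h ∙ q - h ∙ p i) ≈ 0#
        term≈0 = sum≈0⇒≈0 _ (λ i → *-nonNeg (0≤w i) (≤⇒0≤- (S≤ (p∈S i)))) Σ≈0

        new : ∀ i → ∃[ p′ ] (S p′ × h ∙ p′ ≈ h ∙ q) × (∀ j → w i * p i j ≈ w i * p′ j)
        new i with em {w i ≈ 0#}
        ... | yes wᵢ≈0 = q , (q∈S , ≈-refl) , λ j → ≈-trans (zero-mul (p i j)) (≈-sym (zero-mul (q j)))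
          where
          zero-mul : ∀ y → w i * y ≈ 0#
          zero-mul y = ≈-trans (*-congʳ wᵢ≈0) (zeroˡ y)
        ... | no  wᵢ≉0 = p i , (p∈S i , -≈0⇒≈ (*-cancel-0 wᵢ≉0 (term≈0 i))) , λ j → ≈-refl

    -- If `q` alone lies on the supporting hyperplane, all convex combinations there collapse to
    -- `q`. This is used twice: to certify a vertex of `P`, and to find the maximal point of the
    -- neighbotope.
    face-singleton : ∀ h q → S q → (∀ {p} → S p → h ∙ p ≤ h ∙ q) →
                     (∀ {p} → S p → h ∙ p ≈ h ∙ q → p ≋ q) → face (Conv S) h ≐ (_≋ q)
    face-singleton h q q∈S S≤ unique =
      (λ x∈ → to (proj₁ (face-Conv h q q∈S S≤) x∈)) ,
      λ x≋q → proj₂ (face-Conv h q q∈S S≤) (singleton⊆Conv {S = Top h q} (q∈S , ≈-refl) x≋q)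
      where
      to : ∀ {x} → Conv (Top h q) x → x ≋ q
      to (n , w , p , 0≤w , Σw≈1 , p∈ , x≋) j = begin-equality
        _                         ≈⟨ x≋ j ⟩
        sum (λ i → w i * p i j)   ≈⟨ sum-cong-≋ (λ i → *-congˡ (unique (proj₁ (p∈ i)) (proj₂ (p∈ i)) j)) ⟩
        sum (λ i → w i * q j)     ≈⟨ weighted-mean-const w (q j) Σw≈1 ⟩
        q j                       ∎

  -- Termwise comparison of sums, and segments as pieces of rays.

  sum-mono-≤ : ∀ {n} (f g : Fin n → Carrier) → (∀ i → f i ≤ g i) → sum f ≤ sum g
  sum-mono-≤ {ℕ.zero}  f g f≤g = ≤-refl
  sum-mono-≤ {ℕ.suc n} f g f≤g =
    +-mono-≤ (f≤g zero) (sum-mono-≤ (λ i → f (suc i)) (λ i → g (suc i)) λ i → f≤g (suc i))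

  -- A strict loss in one summand cannot be made up by the others. This turns equality of objective
  -- values into equality at every single vertex.
  sum-mono-≤-tight : ∀ {n} (f g : Fin n → Carrier) → (∀ i → f i ≤ g i) → sum g ≤ sum f → ∀ i → g i ≤ f i
  sum-mono-≤-tight {ℕ.suc n} f g f≤g Σg≤Σf = λ where
      zero    → +-cancelʳ-≤ _ (≤-trans Σg≤Σf (+-monoʳ-≤ (f zero) (sum-mono-≤ _ _ λ i → f≤g (suc i))))
      (suc i) → sum-mono-≤-tight (λ i → f (suc i)) (λ i → g (suc i)) (λ i → f≤g (suc i)) tail≤ i
    where
    tail≤ : sum (λ i → g (suc i)) ≤ sum (λ i → f (suc i))
    tail≤ = +-cancelʳ-≤ (g zero) (begin
      sum (λ i → g (suc i)) + g zero   ≈⟨ +-comm _ _ ⟩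
      sum g                            ≤⟨ Σg≤Σf ⟩
      sum f                            ≤⟨ +-monoˡ-≤ _ (f≤g zero) ⟩
      g zero + sum (λ i → f (suc i))   ≈⟨ +-comm _ _ ⟩
      sum (λ i → f (suc i)) + g zero   ∎)

  -- Only the initial piece of the ray, up to parameter `m`. The position `τ` is not rescaled to the
  -- unit interval, so that the drops `t i` of an `ExtremalRay` can serve as positions.
  Ray : ∀ {d} (x g : ℝ^ d) (m : Carrier) → Pred (ℝ^ d) 0ℓ
  Ray x g m r = ∃[ τ ] 0# ≤ τ × τ ≤ m × ∀ j → r j ≈ x j + τ * g j

  -- The position of a convex combination is the weighted mean of the positions, hence again between
  -- 0 and `m`.
  Conv-Ray : ∀ {d} {S : Pred (ℝ^ d) 0ℓ} {x g m} →
             (∀ {r} → S r → Ray x g m r) → ∀ {z} → Conv S z → Ray x g m z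
  Conv-Ray {x = x} {g} {m} S⊆Ray {z} (n , w , p , 0≤w , Σw≈1 , p∈S , z≋) =
    sum (λ i → w i * τ i) ,
    sum-nonNeg _ (λ i → *-nonNeg (0≤w i) (proj₁ (proj₂ (S⊆Ray (p∈S i))))) ,
    ≤-respʳ-≈ (weighted-mean-const w m Σw≈1)
      (sum-mono-≤ _ _ λ i → *-monoˡ-≤ (0≤w i) (proj₁ (proj₂ (proj₂ (S⊆Ray (p∈S i)))))) ,
    λ j → begin-equality
      z j                                                     ≈⟨ z≋ j ⟩
      sum (λ i → w i * p i j)                                 ≈⟨ sum-cong-≋ (λ i → ≈-trans
        (*-congˡ (proj₂ (proj₂ (proj₂ (S⊆Ray (p∈S i)))) j))
        (≈-trans (distribˡ (w i) _ _) (+-congˡ (≈-sym (*-assoc (w i) (τ i) (g j)))))) ⟩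
      sum (λ i → w i * x j + w i * τ i * g j)                 ≈⟨ ∑-distrib-+ (λ i → w i * x j) (λ i → w i * τ i * g j) ⟩
      sum (λ i → w i * x j) + sum (λ i → w i * τ i * g j)     ≈⟨ +-cong (weighted-mean-const w (x j) Σw≈1)
                                                                  (≈-sym (*-distribʳ-sum (g j) λ i → w i * τ i)) ⟩
      x j + sum (λ i → w i * τ i) * g j                       ∎
    where
    τ : Fin n → Carrier
    τ i = proj₁ (S⊆Ray (p∈S i))

  Ray⇒segment : ∀ {d} {x g y : ℝ^ d} {m} → 0# < m → (∀ j → y j ≈ x j + m * g j) →
                ∀ {z} → Ray x g m z → Conv (λ r → r ≋ x ⊎ r ≋ y) z
  Ray⇒segment {d} {x} {g} {y} {m} 0<m y≈ {z} (τ , 0≤τ , τ≤m , z≈) =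
    2 , w , p , 0≤w , Σw≈1 , p∈ , λ j → begin-equality
      z j                                      ≈⟨ z≈ j ⟩
      x j + τ * g j                            ≈⟨ +-cong (*-identityˡ (x j)) (*-congʳ (x/y*y≈x τ 0<m)) ⟨
      1# * x j + lam * m * g j                 ≈⟨ +-congʳ (*-congʳ (//-rightDividesˡ lam 1#)) ⟨
      (1# - lam + lam) * x j + lam * m * g j   ≈⟨ solve 5 (λ e l a b m → (e :+ l) :* a :+ l :* m :* b
                                                    := e :* a :+ (l :* (a :+ m :* b) :+ con 0)) ≈-refl
                                                    (1# - lam) lam (x j) (g j) m ⟩
      (1# - lam) * x j + (lam * (x j + m * g j) + 0#)  ≈⟨ +-congˡ (+-congʳ (*-congˡ (y≈ j))) ⟨
      (1# - lam) * x j + (lam * y j + 0#)      ∎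
    where
    -- The weight of the far end `y`: the position `τ` as a fraction of the whole length `m`.
    lam : Carrier
    lam = τ / m
    w : Fin 2 → Carrier
    w zero    = 1# - lam
    w (suc _) = lam
    p : Fin 2 → ℝ^ d
    p zero    = x
    p (suc _) = y
    lam≤1 : lam ≤ 1#
    lam≤1 = *-cancelˡ-≤ 0<m (begin
      m * lam    ≈⟨ *-comm m lam ⟩
      lam * m    ≈⟨ x/y*y≈x τ 0<m ⟩
      τ          ≤⟨ τ≤m ⟩
      m          ≈⟨ *-identityʳ m ⟨
      m * 1#     ∎)
    0≤w : ∀ i → 0# ≤ w i
    0≤w zero    = ≤⇒0≤- lam≤1
    0≤w (suc _) = *-nonNeg 0≤τ (proj₁ (⁻¹-pos 0<m))
    Σw≈1 : sum w ≈ 1#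
    Σw≈1 = ≈-trans (+-congˡ (+-identityʳ lam)) (//-rightDividesˡ lam 1#)
    p∈ : ∀ i → p i ≋ x ⊎ p i ≋ y
    p∈ zero    = inj₁ λ _ → ≈-refl
    p∈ (suc _) = inj₂ λ _ → ≈-refl

-- Lexicographic objectives and extremal rays.

module Edges (em : ExcludedMiddle 0ℓ) (ℝ : Reals) where
  open Polytopes em ℝ
  open Polytopes.VertexProofs em ℝ hiding (∈-vertices⇔; vertices-unique)
  open OrderedField em ℝ
  open Convexity em ℝ
  open import Relation.Binary.Reasoning.PartialOrder poset

  -- A single objective `h` that ranks by `c` and breaks ties by `f`, with `x` on top. Recovering
  -- the two values from `h` is claimed for the given points only, since `h` is tuned to them; the
  -- converse is linear and holds for all `z`.
  record Lexicographic {n d} (p : Fin n → ℝ^ d) (c f x : ℝ^ d) : Set where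
    field
      h    : ℝ^ d
      h≤   : ∀ i → h ∙ p i ≤ h ∙ x
      h≈⇒  : ∀ i → h ∙ p i ≈ h ∙ x → c ∙ p i ≈ c ∙ x × f ∙ p i ≈ f ∙ x
      ⇒h≈  : ∀ z → c ∙ z ≈ c ∙ x → f ∙ z ≈ f ∙ x → h ∙ z ≈ h ∙ x

  -- For K large, K c + f is maximised by maximising c first and then f.
  lexicographic :
    ∀ {n d} (p : Fin n → ℝ^ d) (c f x : ℝ^ d) →
    (∀ i → c ∙ p i ≤ c ∙ x) → (∀ i → c ∙ p i ≈ c ∙ x → f ∙ p i ≤ f ∙ x) →
    Lexicographic p c f x
  lexicographic {n} {d} p c f x c≤ f≤ = record
    { h   = h
    ; h≤  = h≤
    ; h≈⇒ = h≈⇒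
    ; ⇒h≈ = λ z cz≈ fz≈ → begin-equality
        h ∙ z                  ≈⟨ ∙-combine K c f z ⟩
        K * (c ∙ z) + f ∙ z    ≈⟨ +-cong (*-congˡ cz≈) fz≈ ⟩
        K * (c ∙ x) + f ∙ x    ≈⟨ ∙-combine K c f x ⟨
        h ∙ x                  ∎
    }
    where
    gap rise : Fin n → Carrier
    gap i = c ∙ x - c ∙ p i
    rise i = f ∙ p i - f ∙ x

    -- Where `gap i` is zero, the quotient has no meaning but does no harm: the bound is applied
    -- only at points of positive gap.
    K : Carrier
    K = proj₁ (bounded λ i → rise i / gap i)

    h : ℝ^ d
    h j = K * c j + f j

    module _ (i : Fin n) where
      -- The identity `h ∙ x - h ∙ p i = K * gap i - rise i` without differences: lowering `c` costs
      -- `K * gap i`, which outweighs any gain in `f`.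
      balance : h ∙ p i + K * gap i ≈ h ∙ x + rise i
      balance = begin-equality
        h ∙ p i + K * gap i                       ≈⟨ +-congʳ (∙-combine K c f (p i)) ⟩
        K * (c ∙ p i) + f ∙ p i + K * gap i       ≈⟨ +-congʳ (+-congˡ (//-rightDividesˡ (f ∙ x) (f ∙ p i))) ⟨
        K * (c ∙ p i) + (rise i + f ∙ x) + K * gap i
          ≈⟨ solve 5 (λ k cp r fx g → k :* cp :+ (r :+ fx) :+ k :* g := k :* (g :+ cp) :+ fx :+ r) ≈-refl
               K (c ∙ p i) (rise i) (f ∙ x) (gap i) ⟩
        K * (gap i + c ∙ p i) + f ∙ x + rise i    ≈⟨ +-congʳ (+-congʳ (*-congˡ (//-rightDividesˡ (c ∙ p i) (c ∙ x)))) ⟩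
        K * (c ∙ x) + f ∙ x + rise i              ≈⟨ +-congʳ (∙-combine K c f x) ⟨
        h ∙ x + rise i                            ∎

      h< : ¬ c ∙ p i ≈ c ∙ x → h ∙ p i < h ∙ x
      h< cp≉cx = ≰⇒> λ hx≤hp → <⇒≱ rise<Kgap (+-cancelʳ-≤ (h ∙ x) (begin
        K * gap i + h ∙ x    ≈⟨ +-comm _ _ ⟩
        h ∙ x + K * gap i    ≤⟨ +-monoˡ-≤ _ hx≤hp ⟩
        h ∙ p i + K * gap i  ≈⟨ balance ⟩
        h ∙ x + rise i       ≈⟨ +-comm _ _ ⟩
        rise i + h ∙ x       ∎))
        where
        0<gap : 0# < gap i
        0<gap = ≤⇒0≤- (c≤ i) , λ 0≈gap → cp≉cx (-≈0⇒≈ (≈-sym 0≈gap))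
        rise<Kgap : rise i < K * gap i
        rise<Kgap = ≰⇒> λ Kgap≤rise → <⇒≱ (proj₂ (bounded λ i → rise i / gap i) i) (*-cancelˡ-≤ 0<gap (begin
          gap i * K                  ≈⟨ *-comm _ _ ⟩
          K * gap i                  ≤⟨ Kgap≤rise ⟩
          rise i                     ≈⟨ x/y*y≈x (rise i) 0<gap ⟨
          rise i / gap i * gap i     ≈⟨ *-comm _ _ ⟩
          gap i * (rise i / gap i)   ∎))

    h≤ : ∀ i → h ∙ p i ≤ h ∙ x
    h≤ i with em {c ∙ p i ≈ c ∙ x}
    ... | no cp≉cx = proj₁ (h< i cp≉cx)
    ... | yes cp≈cx = begin
      h ∙ p i                  ≈⟨ ∙-combine K c f (p i) ⟩
      K * (c ∙ p i) + f ∙ p i  ≤⟨ +-mono-≤ (≤-reflexive (*-congˡ cp≈cx)) (f≤ i cp≈cx) ⟩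
      K * (c ∙ x) + f ∙ x      ≈⟨ ∙-combine K c f x ⟨
      h ∙ x                    ∎

    h≈⇒ : ∀ i → h ∙ p i ≈ h ∙ x → c ∙ p i ≈ c ∙ x × f ∙ p i ≈ f ∙ x
    h≈⇒ i hp≈hx with em {c ∙ p i ≈ c ∙ x}
    ... | no cp≉cx = contradiction hp≈hx (proj₂ (h< i cp≉cx))
    ... | yes cp≈cx = cp≈cx , +-cancelˡ (K * (c ∙ x)) _ _ (begin-equality
      K * (c ∙ x) + f ∙ p i    ≈⟨ +-congʳ (*-congˡ cp≈cx) ⟨
      K * (c ∙ p i) + f ∙ p i  ≈⟨ ∙-combine K c f (p i) ⟨
      h ∙ p i                  ≈⟨ hp≈hx ⟩
      h ∙ x                    ≈⟨ ∙-combine K c f x ⟩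
      K * (c ∙ x) + f ∙ x      ∎)

  -- Among the points indexed by `S`, those maximising `f` lie on one ray from `x` along `g`, and
  -- `p y` is the farthest of them. The drop `t` of `a` below its value at `x` measures the position
  -- on the ray.
  record ExtremalRay {n d} (p : Fin n → ℝ^ d) (S : Pred (Fin n) 0ℓ) (a x : ℝ^ d) : Set where
    t : Fin n → Carrier
    t i = a ∙ x - a ∙ p i

    field
      f g  : ℝ^ d
      y    : Fin n
      y∈S  : y ∈ S
      0<ty : 0# < t y
      fy≈  : f ∙ p y ≈ f ∙ x
      f≤   : ∀ i → i ∈ S → f ∙ p i ≤ f ∙ x
      f≈⇒  : ∀ i → i ∈ S → f ∙ p i ≈ f ∙ x → t i ≤ t y × ∀ j → p i j ≈ x j + t i * g j

  -- Each point pᵢ ≠ x has a direction (pᵢ − x) / (a∙x − a∙pᵢ) in the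
  -- hyperplane a = −1.  A direction g of maximal length is the unique maximum
  -- of g itself over all directions, so g + (g∙g) a is maximal exactly on the
  -- ray from x along g.
  extremal-ray :
    ∀ {n d} (p : Fin n → ℝ^ d) (S : Pred (Fin n) 0ℓ) (a x : ℝ^ d) →
    (∀ i → i ∈ S → a ∙ p i ≤ a ∙ x) → (∀ i → i ∈ S → a ∙ p i ≈ a ∙ x → p i ≋ x) →
    ∃[ i ] i ∈ S × ¬ p i ≋ x → ExtremalRay p S a x
  extremal-ray {n} {d} p S a x a≤ a≈ (i₀ , i₀∈S , pi₀≉x) = record
    { f    = f
    ; g    = g
    ; y    = y
    ; y∈S  = proj₁ y∈
    ; 0<ty = 0<t y (proj₁ y∈) (proj₁ (proj₂ y∈))
    ; fy≈  = on-ray⇒f≈ y (proj₂ (proj₂ y∈))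
    ; f≤   = f≤
    ; f≈⇒  = f≈⇒
    }
    where
    t : Fin n → Carrier
    t i = a ∙ x - a ∙ p i

    dir : Fin n → ℝ^ d
    dir i j = (p i j - x j) / t i

    0<t : ∀ i → i ∈ S → ¬ p i ≋ x → 0# < t i
    0<t i i∈S pi≉x = ≤⇒0≤- (a≤ i i∈S) , λ 0≈t → pi≉x (a≈ i i∈S (-≈0⇒≈ (≈-sym 0≈t)))

    OnRay : ℝ^ d → Fin n → Set
    OnRay e i = ∀ j → p i j ≈ x j + t i * e j

    on-own-ray : ∀ i → i ∈ S → ¬ p i ≋ x → OnRay (dir i) i
    on-own-ray i i∈S pi≉x j = begin-equality
      p i j                      ≈⟨ //-rightDividesˡ (x j) (p i j) ⟨
      p i j - x j + x j          ≈⟨ +-comm _ _ ⟩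
      x j + (p i j - x j)        ≈⟨ +-congˡ (x/y*y≈x (p i j - x j) (0<t i i∈S pi≉x)) ⟨
      x j + dir i j * t i        ≈⟨ +-congˡ (*-comm _ _) ⟩
      x j + t i * dir i j        ∎

    longest : ∃[ m ] (m ∈ S × ¬ p m ≋ x) × (∀ i → i ∈ S × ¬ p i ≋ x → dir i ∙ dir i ≤ dir m ∙ dir m)
    longest = maximum (λ i → dir i ∙ dir i) (λ i → i ∈ S × ¬ p i ≋ x) (i₀ , i₀∈S , pi₀≉x)

    m : Fin n
    m = proj₁ longest

    m∈ : m ∈ S × ¬ p m ≋ x
    m∈ = proj₁ (proj₂ longest)

    g f : ℝ^ d
    g = dir m
    f j = (g ∙ g) * a j + g j

    -- This says `f ∙ p i - f ∙ x = t i * (g ∙ e - g ∙ g)`. Since `t i` is positive for points other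
    -- than `x`, comparing values of `f` amounts to comparing `g ∙ e` with `g ∙ g`.
    balance : ∀ e i → OnRay e i → f ∙ p i + t i * (g ∙ g) ≈ f ∙ x + t i * (g ∙ e)
    balance e i ray = begin-equality
      f ∙ p i + t i * (g ∙ g)
        ≈⟨ +-congʳ (∙-combine (g ∙ g) a g (p i)) ⟩
      (g ∙ g) * (a ∙ p i) + g ∙ p i + t i * (g ∙ g)
        ≈⟨ +-congʳ (+-congˡ (≈-trans (∙-congʳ g ray) (≈-trans (∙-+ g x _) (+-congˡ (∙-* g e (t i)))))) ⟩
      (g ∙ g) * (a ∙ p i) + (g ∙ x + t i * (g ∙ e)) + t i * (g ∙ g)
        ≈⟨ solve 5 (λ gg ap gx t ge → gg :* ap :+ (gx :+ t :* ge) :+ t :* gg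
                                      := gg :* (t :+ ap) :+ gx :+ t :* ge) ≈-refl
             (g ∙ g) (a ∙ p i) (g ∙ x) (t i) (g ∙ e) ⟩
      (g ∙ g) * (t i + a ∙ p i) + g ∙ x + t i * (g ∙ e)
        ≈⟨ +-congʳ (+-congʳ (*-congˡ (//-rightDividesˡ (a ∙ p i) (a ∙ x)))) ⟩
      (g ∙ g) * (a ∙ x) + g ∙ x + t i * (g ∙ e)
        ≈⟨ +-congʳ (∙-combine (g ∙ g) a g x) ⟨
      f ∙ x + t i * (g ∙ e) ∎

    on-ray⇒f≈ : ∀ i → OnRay g i → f ∙ p i ≈ f ∙ x
    on-ray⇒f≈ i ray = +-cancelʳ (t i * (g ∙ g)) _ _ (balance g i ray)

    f≤ : ∀ i → i ∈ S → f ∙ p i ≤ f ∙ x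
    f≤ i i∈S with em {p i ≋ x}
    ... | yes pi≋x = ≤-reflexive (∙-congʳ f pi≋x)
    ... | no  pi≉x = +-cancelʳ-≤ (t i * (g ∙ g)) (begin
      f ∙ p i + t i * (g ∙ g)      ≈⟨ balance (dir i) i (on-own-ray i i∈S pi≉x) ⟩
      f ∙ x + t i * (g ∙ dir i)    ≤⟨ +-monoʳ-≤ _ (*-monoˡ-≤ (proj₁ (0<t i i∈S pi≉x))
                                        (longest-∙ g (dir i) (proj₂ (proj₂ longest) i (i∈S , pi≉x)))) ⟩
      f ∙ x + t i * (g ∙ g)        ∎)

    f≈⇒on-ray : ∀ i → i ∈ S → ¬ p i ≋ x → f ∙ p i ≈ f ∙ x → OnRay g i
    f≈⇒on-ray i i∈S pi≉x fp≈fx j = ≈-trans (on-own-ray i i∈S pi≉x j) (+-congˡ (*-congˡ (dir≋g j)))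
      where
      dir≋g : dir i ≋ g
      dir≋g = longest-∙-unique g (dir i) (proj₂ (proj₂ longest) i (i∈S , pi≉x))
        (*-cancelˡ (0<t i i∈S pi≉x) (+-cancelˡ (f ∙ x) _ _ (begin-equality
          f ∙ x + t i * (g ∙ dir i)  ≈⟨ balance (dir i) i (on-own-ray i i∈S pi≉x) ⟨
          f ∙ p i + t i * (g ∙ g)    ≈⟨ +-congʳ fp≈fx ⟩
          f ∙ x + t i * (g ∙ g)      ∎)))

    -- Several of the points may share the direction `g`; the far end of the edge is the last one on
    -- the ray.
    farthest : ∃[ y ] (y ∈ S × ¬ p y ≋ x × OnRay g y) ×
                      (∀ i → i ∈ S × ¬ p i ≋ x × OnRay g i → t i ≤ t y)
    farthest = maximum t (λ i → i ∈ S × ¬ p i ≋ x × OnRay g i)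
      (m , proj₁ m∈ , proj₂ m∈ , on-own-ray m (proj₁ m∈) (proj₂ m∈))

    y : Fin n
    y = proj₁ farthest

    y∈ : y ∈ S × ¬ p y ≋ x × OnRay g y
    y∈ = proj₁ (proj₂ farthest)

    f≈⇒ : ∀ i → i ∈ S → f ∙ p i ≈ f ∙ x → t i ≤ t y × OnRay g i
    f≈⇒ i i∈S fp≈fx with em {p i ≋ x}
    ... | no pi≉x = let ray = f≈⇒on-ray i i∈S pi≉x fp≈fx in
      proj₂ (proj₂ farthest) i (i∈S , pi≉x , ray) , ray
    ... | yes pi≋x =
        ≤-respˡ-≈ (≈-sym t≈0) (proj₁ (0<t y (proj₁ y∈) (proj₁ (proj₂ y∈)))) , λ j → begin-equality
        p i j               ≈⟨ pi≋x j ⟩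
        x j                 ≈⟨ +-identityʳ (x j) ⟨
        x j + 0#            ≈⟨ +-congˡ (≈-trans (*-congʳ t≈0) (zeroˡ (g j))) ⟨
        x j + t i * g j     ∎
      where
      t≈0 : t i ≈ 0#
      t≈0 = ≈-trans (+-congˡ (-‿cong (∙-congʳ a pi≋x))) (-‿inverseʳ (a ∙ x))

  -- An edge at a vertex of a face.

  module _ {d : ℕ} (P : Polytope d) where
    open Setoid (≋-setoid d) using () renaming (refl to ≋-refl; sym to ≋-sym; trans to ≋-trans)

    private
      point : Fin (length (points P)) → ℝ^ d
      point = lookup (points P)

    ∈points⇒index : ∀ {r} → r ∈ₗ points P → ∃[ i ] r ≋ point i
    ∈points⇒index r∈ = Any.index r∈ , Any.lookup-index r∈

    point∈points : ∀ i → point i ∈ₗ points P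
    point∈points = Membership.∈-lookup (≋-setoid d) (points P)

    point-≤ : ∀ (h : ℝ^ d) {b} → (∀ i → h ∙ point i ≤ b) → ∀ {r} → r ∈ₗ points P → h ∙ r ≤ b
    point-≤ h h≤b r∈ = let i , r≋ = ∈points⇒index r∈ in ≤-respˡ-≈ (∙-congʳ h (≋-sym r≋)) (h≤b i)

    -- Let `a` expose `x`. An extremal ray through the spanning points on the `c`-face gives `f`.
    -- Maximising `c` and then `f` exposes the segment from `x` to the last spanning point `q` on
    -- that ray. As `q` lies on the `c`-face, `c` takes the same value at both ends.
    edge-in-face : ∀ c {x v} → IsVertex ⟦ P ⟧ x → x ∈ face ⟦ P ⟧ c → v ∈ₗ points P → v ∈ face ⟦ P ⟧ c → ¬ v ≋ x →
                   ∃[ q ] IsVertex ⟦ P ⟧ q × IsEdge ⟦ P ⟧ x q × c ∙ x ≈ c ∙ q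
    edge-in-face c {x} {v} x-vertex@(a , to-x , from-x) (x∈P , x-max) v∈points (v∈P , v-max) v≉x =
      q , q-IsVertex , (x≉q , h , to , from) , ≈-sym y∈S
      where
      x∈points : x ∈ₗ points P
      x∈points = vertex∈points P x-vertex

      point∈P : ∀ i → point i ∈ ⟦ P ⟧
      point∈P i = points⊆hull P (point∈points i)

      a≤ : ∀ i → a ∙ point i ≤ a ∙ x
      a≤ i = proj₂ (from-x ≋-refl) (point i) (point∈P i)

      a≈ : ∀ i → a ∙ point i ≈ a ∙ x → point i ≋ x
      a≈ i e = to-x (point∈P i , λ z z∈ → ≤-respʳ-≈ (≈-sym e) (proj₂ (from-x ≋-refl) z z∈))

      OnFace : Pred (Fin (length (points P))) 0ℓ
      OnFace i = c ∙ point i ≈ c ∙ x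

      other : ∃[ i ] i ∈ OnFace × ¬ point i ≋ x
      other = let i , v≋ = ∈points⇒index v∈points in
        i , ≈-trans (∙-congʳ c (≋-sym v≋)) (antisym (x-max _ v∈P) (v-max _ x∈P)) , λ i≋x → v≉x (≋-trans v≋ i≋x)

      abstract
        ray : ExtremalRay point OnFace a x
        ray = extremal-ray point OnFace a x (λ i _ → a≤ i) (λ i _ → a≈ i) other

      open ExtremalRay ray

      q : ℝ^ d
      q = point y

      abstract
        lex-x : Lexicographic point c f x
        lex-x = lexicographic point c f x (λ i → x-max (point i) (point∈P i)) f≤

      open Lexicographic lex-x

      hq≈hx : h ∙ q ≈ h ∙ x
      hq≈hx = ⇒h≈ q y∈S fy≈

      h≈⇒on-ray : ∀ i → h ∙ point i ≈ h ∙ x → t i ≤ t y × ∀ j → point i j ≈ x j + t i * g j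
      h≈⇒on-ray i e = let ce , fe = h≈⇒ i e in f≈⇒ i ce fe

      -a : ℝ^ d
      -a j = - 1# * a j

      -a∙ : ∀ z → -a ∙ z ≈ - (a ∙ z)
      -a∙ z = begin-equality
        -a ∙ z           ≈⟨ ∙-comm -a z ⟩
        z ∙ -a           ≈⟨ ∙-* z a (- 1#) ⟩
        - 1# * (z ∙ a)   ≈⟨ -1*x≈-x (z ∙ a) ⟩
        - (z ∙ a)        ≈⟨ -‿cong (∙-comm z a) ⟩
        - (a ∙ z)        ∎

      t+ : ∀ i → -a ∙ point i + a ∙ x ≈ t i
      t+ i = ≈-trans (+-comm _ _) (+-congˡ (-a∙ (point i)))

      abstract
        -- On the ray, `-a` grows with the distance from `x`. Breaking the ties of `h` by `-a`
        -- therefore leaves only the far end, which shows that `q` is a vertex.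
        lex-q : Lexicographic point h -a q
        lex-q = lexicographic point h -a q
          (λ i → ≤-respʳ-≈ (≈-sym hq≈hx) (h≤ i))
          (λ i e → +-cancelʳ-≤ (a ∙ x) (≤-respʳ-≈ (≈-sym (t+ y)) (≤-respˡ-≈ (≈-sym (t+ i))
                     (proj₁ (h≈⇒on-ray i (≈-trans e hq≈hx))))))

      module Q = Lexicographic lex-q

      q-unique : ∀ i → Q.h ∙ point i ≈ Q.h ∙ q → point i ≋ q
      q-unique i e j = begin-equality
        point i j          ≈⟨ proj₂ (h≈⇒on-ray i (≈-trans he hq≈hx)) j ⟩
        x j + t i * g j    ≈⟨ +-congˡ (*-congʳ (≈-trans (≈-sym (t+ i)) (≈-trans (+-congʳ -ae) (t+ y)))) ⟩
        x j + t y * g j    ≈⟨ proj₂ (h≈⇒on-ray y hq≈hx) j ⟨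
        q j                ∎
        where
        he : h ∙ point i ≈ h ∙ q
        he = proj₁ (Q.h≈⇒ i e)
        -ae : -a ∙ point i ≈ -a ∙ q
        -ae = proj₂ (Q.h≈⇒ i e)

      q-IsVertex : IsVertex ⟦ P ⟧ q
      q-IsVertex = Q.h , face-singleton Q.h q (point∈points y)
        (point-≤ Q.h Q.h≤)
        λ r∈ e → let i , r≋ = ∈points⇒index r∈ in
          ≋-trans r≋ (q-unique i (≈-trans (∙-congʳ Q.h (≋-sym r≋)) e))

      x≉q : ¬ x ≋ q
      x≉q x≋q = proj₂ 0<ty (≈-sym (≈-trans (+-congˡ (-‿cong (∙-congʳ a (≋-sym x≋q)))) (-‿inverseʳ (a ∙ x))))

      face-h : face ⟦ P ⟧ h ≐ Conv (λ r → r ∈ₗ points P × h ∙ r ≈ h ∙ x)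
      face-h = face-Conv h x x∈points (point-≤ h h≤)

      on-ray : ∀ {r} → r ∈ₗ points P × h ∙ r ≈ h ∙ x → Ray x g (t y) r
      on-ray (r∈ , hr≈hx) =
        let i , r≋ = ∈points⇒index r∈
            ti≤ty , pi≈ = h≈⇒on-ray i (≈-trans (∙-congʳ h (≋-sym r≋)) hr≈hx)
        in t i , ≤⇒0≤- (a≤ i) , ti≤ty , λ j → ≈-trans (r≋ j) (pi≈ j)

      to : ∀ {z} → z ∈ face ⟦ P ⟧ h → Conv (λ r → r ≋ x ⊎ r ≋ q) z
      to z∈ = Ray⇒segment 0<ty (proj₂ (h≈⇒on-ray y hq≈hx)) (Conv-Ray on-ray (proj₁ face-h z∈))

      endpoint : ∀ {r} → r ≋ x ⊎ r ≋ q → r ∈ₗ points P × h ∙ r ≈ h ∙ x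
      endpoint (inj₁ r≋x) = Membership.∈-resp-≈ (≋-setoid d) (≋-sym r≋x) x∈points , ∙-congʳ h r≋x
      endpoint (inj₂ r≋q) =
        Membership.∈-resp-≈ (≋-setoid d) (≋-sym r≋q) (point∈points y) , ≈-trans (∙-congʳ h r≋q) hq≈hx

      from : ∀ {z} → Conv (λ r → r ≋ x ⊎ r ≋ q) z → z ∈ face ⟦ P ⟧ h
      from z∈ = proj₂ face-h (Conv-mono (λ {r} → endpoint {r}) z∈)

    -- Vertices and their indices.

    vertex-IsVertex : ∀ v → IsVertex ⟦ P ⟧ (vertex P v)
    vertex-IsVertex v = Equivalence.to (∈-vertices⇔ P) (Membership.∈-lookup (≋-setoid d) (vertices P) v)

    vertex∈hull : ∀ v → vertex P v ∈ ⟦ P ⟧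
    vertex∈hull v = points⊆hull P (vertex∈points P (vertex-IsVertex v))

    IsVertex⇒index : ∀ {q} → IsVertex ⟦ P ⟧ q → ∃[ w ] q ≋ vertex P w
    IsVertex⇒index q-vertex = let q∈ = Equivalence.from (∈-vertices⇔ P) q-vertex
                              in Any.index q∈ , Any.lookup-index q∈

    vertex-injective : ∀ u v → vertex P u ≋ vertex P v → u ≡ v
    vertex-injective u v = lookup-injective (vertices-unique P) u v
      where
      lookup∈ : ∀ {xs r} {i : Fin (length xs)} → lookup xs i ≋ r → r ∈ₗ xs
      lookup∈ {xs} e = Membership.∈-resp-≈ (≋-setoid d) e (Membership.∈-lookup (≋-setoid d) xs _)

      lookup-injective : ∀ {xs} → Unique (≋-setoid d) xs → ∀ i j → lookup xs i ≋ lookup xs j → i ≡ j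
      lookup-injective (x∉xs ∷ xs!) zero    zero    e = refl
      lookup-injective (x∉xs ∷ xs!) zero    (suc j) e = contradiction (lookup∈ (≋-sym e)) (All.All¬⇒¬Any x∉xs)
      lookup-injective (x∉xs ∷ xs!) (suc i) zero    e = contradiction (lookup∈ e) (All.All¬⇒¬Any x∉xs)
      lookup-injective (x∉xs ∷ xs!) (suc i) (suc j) e = cong suc (lookup-injective xs! i j e)

-- Steps along edges and arborescences.

module Neighbotopes
  (em : ExcludedMiddle 0ℓ) (ℝ : Reals) {d : ℕ} (P : Polytopes.Polytope em ℝ d)
  (η : Polytopes.ℝ^_ em ℝ d → Reals.Carrier ℝ) (η-normalization : Polytopes.IsNormalization em ℝ P η)
  where
  open Polytopes em ℝ
  open Polytopes.VertexProofs em ℝ hiding (∈-vertices⇔; vertices-unique)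
  open OrderedField em ℝ
  open Convexity em ℝ
  open Edges em ℝ
  open Setoid (≋-setoid d) using () renaming (refl to ≋-refl; sym to ≋-sym; trans to ≋-trans)
  open import Algebra.Properties.Semiring.Sum semiring using (sum-cong-≋)
  open import Relation.Binary.Reasoning.PartialOrder poset
  open Endo (V P) using (_^_)

  IsEdge-sym : ∀ {Q u v} → IsEdge {d} Q u v → IsEdge Q v u
  IsEdge-sym {u = u} {v} (u≉v , c , to , from) =
    (λ v≋u → u≉v (≋-sym v≋u)) , c ,
    (λ z∈ → Conv-mono (λ {r} → swap {A = r ≋ u} {B = r ≋ v}) (to z∈)) ,
    λ z∈ → from (Conv-mono (λ {r} → swap {A = r ≋ v} {B = r ≋ u}) z∈)

  IsEdge-respʳ : ∀ {Q u v v′} → v ≋ v′ → IsEdge {d} Q u v → IsEdge Q u v′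
  IsEdge-respʳ {u = u} {v} {v′} v≋v′ (u≉v , c , to , from) =
    (λ u≋v′ → u≉v (≋-trans u≋v′ (≋-sym v≋v′))) , c ,
    (λ z∈ → Conv-mono (λ {r} → move r v≋v′) (to z∈)) ,
    λ z∈ → from (Conv-mono (λ {r} → move r (≋-sym v≋v′)) z∈)
    where
    move : ∀ r {v v′} → v ≋ v′ → r ≋ u ⊎ r ≋ v → r ≋ u ⊎ r ≋ v′
    move r v≋v′ (inj₁ r≋u) = inj₁ r≋u
    move r v≋v′ (inj₂ r≋v) = inj₂ (≋-trans r≋v v≋v′)

  -- The local condition that every arborescence satisfies at each vertex. Comparing the pivot map
  -- with all maps of this kind lets the maximisation split into independent choices, one for each
  -- vertex.
  Step : V P → V P → Set
  Step v u = u ≡ v ⊎ Adjacent P v u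

  0<η : ∀ {v u} → Adjacent P v u → 0# < η (vertex P u -ᵥ vertex P v)
  0<η {v} {u} vu = IsNormalization.positive η-normalization u v (IsEdge-sym vu)

  arborescence-step : ∀ {B} → IsArborescence P B → ∀ v → Step v (B v)
  arborescence-step B-arb v with em {v ≡ IsArborescence.root B-arb}
  ... | yes refl  = inj₁ (proj₁ (proj₂ (IsArborescence.uniqueRoot B-arb)))
  ... | no v≢root = inj₂ (IsArborescence.adjacent B-arb v v≢root)

  module _ {B B′ : V P → V P} (B≗B′ : B ≗ B′) where

    ^-cong : ∀ k v → (B ^ k) v ≡ (B′ ^ k) v
    ^-cong ℕ.zero    v = refl
    ^-cong (ℕ.suc k) v = ≡.trans (B≗B′ _) (cong B′ (^-cong k v))

    -- Encoding a map by a number and decoding it returns the map only up to pointwise equality.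
    IsArborescence-resp : IsArborescence P B → IsArborescence P B′
    IsArborescence-resp B-arb = record
      { uniqueRoot = root , ≡.trans (≡.sym (B≗B′ root)) (proj₁ (proj₂ uniqueRoot)) ,
                     λ {v} fixed → proj₂ (proj₂ uniqueRoot) (≡.trans (B≗B′ v) fixed)
      ; adjacent   = λ v v≢root → ≡.subst (Adjacent P v) (B≗B′ v) (adjacent v v≢root)
      ; reaches    = λ v → let k , 1≤k , e = reaches v in k , 1≤k , ≡.trans (≡.sym (^-cong k v)) e
      }
      where open IsArborescence B-arb

    ψ-cong : ψ P η B ≋ ψ P η B′
    ψ-cong j = sum-cong-≋ λ v →
      reflexive (cong (λ u → let δ = vertex P u -ᵥ vertex P v in δ j / η δ) (B≗B′ v))

  ^-shift : ∀ (f : V P → V P) k v → (f ^ ℕ.suc k) v ≡ (f ^ k) (f v)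
  ^-shift f ℕ.zero    v = refl
  ^-shift f (ℕ.suc k) v = cong f (^-shift f k v)

  -- Slopes of steps.

  module _ (c : ℝ^ d) where

    ∙-ψ : ∀ B → c ∙ ψ P η B ≈ sum λ v → slope P η c v (B v)
    ∙-ψ B = begin-equality
      c ∙ ψ P η B                                     ≈⟨ ∙-congʳ c (λ j → sum-cong-≋ λ v → *-comm (δ v j) (η (δ v) ⁻¹)) ⟩
      c ∙ (λ j → sum λ v → η (δ v) ⁻¹ * δ v j)        ≈⟨ ∙-sum c (λ v → η (δ v) ⁻¹) δ ⟩
      sum (λ v → η (δ v) ⁻¹ * (c ∙ δ v))              ≈⟨ sum-cong-≋ (λ v → *-comm (η (δ v) ⁻¹) (c ∙ δ v)) ⟩
      sum (λ v → slope P η c v (B v))                 ∎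
      where
      δ : V P → ℝ^ d
      δ v = vertex P (B v) -ᵥ vertex P v

    slope-self : ∀ v → slope P η c v v ≈ 0#
    slope-self v = ≈-trans (*-congʳ c∙δ≈0) (zeroˡ _)
      where
      c∙δ≈0 : c ∙ (vertex P v -ᵥ vertex P v) ≈ 0#
      c∙δ≈0 = +-cancelʳ (c ∙ vertex P v) _ _ (≈-trans (∙-- c (vertex P v) (vertex P v)) (≈-sym (+-identityˡ _)))

    module _ {v u} (vu : Adjacent P v u) where

      -- The slope with its denominator cleared. As `η` is positive on edges, the sign of the slope
      -- tells whether `c` increases along the edge.
      slope-balance : η (vertex P u -ᵥ vertex P v) * slope P η c v u + c ∙ vertex P v ≈ c ∙ vertex P u
      slope-balance = ≈-trans (+-congʳ (≈-trans (*-comm _ _) (x/y*y≈x _ (0<η vu))))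
                              (∙-- c (vertex P u) (vertex P v))

      slope≤0⇒ : slope P η c v u ≤ 0# → c ∙ vertex P u ≤ c ∙ vertex P v
      slope≤0⇒ s≤0 = begin
        c ∙ vertex P u                                   ≈⟨ slope-balance ⟨
        _ * slope P η c v u + c ∙ vertex P v             ≤⟨ +-monoˡ-≤ _ (*-monoˡ-≤ (proj₁ (0<η vu)) s≤0) ⟩
        _ * 0# + c ∙ vertex P v                          ≈⟨ ≈-trans (+-congʳ (zeroʳ _)) (+-identityˡ _) ⟩
        c ∙ vertex P v                                   ∎

      0≤slope⇒ : 0# ≤ slope P η c v u → c ∙ vertex P v ≤ c ∙ vertex P u
      0≤slope⇒ 0≤s = begin
        c ∙ vertex P v                                   ≈⟨ +-identityˡ _ ⟨
        0# + c ∙ vertex P v                              ≤⟨ +-monoˡ-≤ _ (*-nonNeg (proj₁ (0<η vu)) 0≤s) ⟩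
        _ * slope P η c v u + c ∙ vertex P v             ≈⟨ slope-balance ⟩
        c ∙ vertex P u                                   ∎

  -- The pivot map of a generic objective.

  module _ {c : ℝ^ d} (generic : Generic P η c) where
    open Generic generic

    private
      B : V P → V P
      B = pivot P η c generic

    pivot-optimal : ∀ v → Optimal P η c v → B v ≡ v
    pivot-optimal v v-opt with em {Optimal P η c v}
    ... | yes _     = refl
    ... | no ¬v-opt = contradiction v-opt ¬v-opt

    pivot-argmax : ∀ v → ¬ Optimal P η c v →
                   IsArgmax P η c v (B v) × (∀ {u} → IsArgmax P η c v u → B v ≡ u)
    pivot-argmax v ¬v-opt with em {Optimal P η c v}
    ... | yes v-opt = contradiction v-opt ¬v-opt
    ... | no ¬v-opt = proj₂ (argmax v ¬v-opt)

    -- Opaque, so that a case split on it does not also split on the excluded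
    -- middle inside pivot.
    abstract
      optimal? : ∀ v → Dec (Optimal P η c v)
      optimal? v = em

    optimal-unique : ∀ {u v} → Optimal P η c u → Optimal P η c v → u ≡ v
    optimal-unique {u} {v} u-opt v-opt with em {u ≡ v}
    ... | yes u≡v = u≡v
    ... | no  u≢v =
      let q , q-vertex , uq , cu≈cq = edge-in-face P c (vertex-IsVertex P u) u-opt
            (vertex∈points P (vertex-IsVertex P v)) v-opt λ v≋u → u≢v (vertex-injective P u v (≋-sym v≋u))
          w , q≋w = IsVertex⇒index P q-vertex
      in contradiction (≈-trans cu≈cq (∙-congʳ c q≋w)) (edges u w (IsEdge-respʳ q≋w uq))

    -- Away from the optimum the pivot moves along an edge, and the ends of an edge are distinct.
    fixed⇒optimal : ∀ v → B v ≡ v → Optimal P η c v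
    fixed⇒optimal v Bv≡v with optimal? v
    ... | yes v-opt = v-opt
    ... | no ¬v-opt = contradiction ≋-refl
      (proj₁ (≡.subst (Adjacent P v) Bv≡v (proj₁ (proj₁ (proj₁ (pivot-argmax v ¬v-opt))))))

    -- Each pivot step away from the optimum strictly increases `c`, so the walk through the
    -- finitely many vertices must end there.
    reaches-optimal : ∀ v → ∃[ k ] 1 ℕ.≤ k × Optimal P η c ((B ^ k) v)
    reaches-optimal v = climb v (<-on-noetherian (λ v → c ∙ vertex P v) v)
      where
      climb : ∀ v → Acc (λ u u′ → c ∙ vertex P u′ < c ∙ vertex P u) v →
              ∃[ k ] 1 ℕ.≤ k × Optimal P η c ((B ^ k) v)
      climb v (acc rec) with optimal? v
      -- At least one iteration is demanded; at the optimum it is a step that stays in place.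
      ... | yes v-opt = 1 , ℕ.s≤s ℕ.z≤n , ≡.subst (Optimal P η c) (≡.sym (pivot-optimal v v-opt)) v-opt
      ... | no ¬v-opt =
        let k , _ , opt = climb (B v) (rec (proj₂ (proj₁ (proj₁ (pivot-argmax v ¬v-opt)))))
        in ℕ.suc k , ℕ.s≤s ℕ.z≤n , ≡.subst (Optimal P η c) (≡.sym (^-shift B k v)) opt

    -- The vertex `v₀` is where the climb to the root begins; an empty `P` has no root at all.
    pivot-arborescence : V P → IsArborescence P B
    pivot-arborescence v₀ = record
      { uniqueRoot = r , pivot-optimal r r-opt , λ {v} fixed → optimal-unique r-opt (fixed⇒optimal v fixed)
      ; adjacent   = λ v v≢r → proj₁ (proj₁ (proj₁ (pivot-argmax v λ v-opt → v≢r (optimal-unique v-opt r-opt))))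
      ; reaches    = λ v → let k , 1≤k , opt = reaches-optimal v in k , 1≤k , optimal-unique opt r-opt
      }
      where
      r : V P
      r = (B ^ proj₁ (reaches-optimal v₀)) v₀
      r-opt : Optimal P η c r
      r-opt = proj₂ (proj₂ (reaches-optimal v₀))

    -- Genericity excludes edges on which `c` is constant, so the weak inequality is already strict.
    0≤slope⇒improving : ∀ {v u} → Adjacent P v u → 0# ≤ slope P η c v u → Improving P η c v u
    0≤slope⇒improving {v} {u} vu 0≤s = vu , 0≤slope⇒ c vu 0≤s , edges v u vu

    improving⇒0<slope : ∀ {v u} → Improving P η c v u → 0# < slope P η c v u
    improving⇒0<slope (vu , v<u) = ≰⇒> λ s≤0 → <⇒≱ v<u (slope≤0⇒ c vu s≤0)

    -- Staying has slope 0. At the optimum an edge of nonnegative slope would lead to a higher value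
    -- of `c`. Elsewhere the pivot step has positive slope, which beats staying and all edges of
    -- negative slope; the remaining edges are improving and compete in the argmax.
    pivot-steepest : ∀ v u → Step v u → u ≡ B v ⊎ slope P η c v u < slope P η c v (B v)
    pivot-steepest v u step with optimal? v
    pivot-steepest v u (inj₁ u≡v) | yes v-opt = inj₁ (≡.trans u≡v (≡.sym (pivot-optimal v v-opt)))
    pivot-steepest v u (inj₂ vu)  | yes v-opt =
      inj₂ (≡.subst (λ w → slope P η c v u < slope P η c v w) (≡.sym (pivot-optimal v v-opt))
        (<-respʳ-≈ (≈-sym (slope-self c v))
          (≰⇒> λ 0≤s → <⇒≱ (proj₂ (0≤slope⇒improving vu 0≤s)) (proj₂ v-opt _ (vertex∈hull P u)))))
    pivot-steepest v u (inj₁ refl) | no ¬v-opt =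
      inj₂ (<-respˡ-≈ (≈-sym (slope-self c v)) (improving⇒0<slope (proj₁ (proj₁ (pivot-argmax v ¬v-opt)))))
    pivot-steepest v u (inj₂ vu) | no ¬v-opt with em {0# ≤ slope P η c v u}
    ... | no  0≰s = inj₂ (begin-strict
      slope P η c v u        <⟨ ≰⇒> 0≰s ⟩
      0#                     <⟨ improving⇒0<slope (proj₁ (proj₁ (pivot-argmax v ¬v-opt))) ⟩
      slope P η c v (B v)    ∎)
    ... | yes 0≤s with em {slope P η c v (B v) ≤ slope P η c v u}
    ...   | no  Bv≰u = inj₂ (≰⇒> Bv≰u)
    -- A step that ties with the pivot step is itself an argmax, so uniqueness identifies the two.
    ...   | yes Bv≤u = inj₁ (≡.sym (proj₂ (pivot-argmax v ¬v-opt)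
      (0≤slope⇒improving vu 0≤s , λ u′ imp → ≤-trans (proj₂ (proj₁ (pivot-argmax v ¬v-opt)) u′ imp) Bv≤u)))

    module _ (B′ : V P → V P) (steps : ∀ v → Step v (B′ v)) where

      slope-≤-pivot : ∀ v → slope P η c v (B′ v) ≤ slope P η c v (B v)
      slope-≤-pivot v with pivot-steepest v (B′ v) (steps v)
      ... | inj₁ B′v≡Bv = ≤-reflexive (reflexive (cong (slope P η c v) B′v≡Bv))
      ... | inj₂ s<s    = proj₁ s<s

      ψ-≤-pivot : c ∙ ψ P η B′ ≤ c ∙ ψ P η B
      ψ-≤-pivot = ≤-respˡ-≈ (≈-sym (∙-ψ c B′)) (≤-respʳ-≈ (≈-sym (∙-ψ c B)) (sum-mono-≤ _ _ slope-≤-pivot))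

      -- Both sides are sums of slopes compared term by term. Equal sums leave no strict term, and a
      -- step that is not strictly worse is the pivot step.
      ψ-≈-pivot⇒≗ : c ∙ ψ P η B′ ≈ c ∙ ψ P η B → B′ ≗ B
      ψ-≈-pivot⇒≗ e v with pivot-steepest v (B′ v) (steps v)
      ... | inj₁ B′v≡Bv = B′v≡Bv
      ... | inj₂ s<s    = contradiction
        (sum-mono-≤-tight _ _ slope-≤-pivot (≤-reflexive (≈-trans (≈-sym (∙-ψ c B)) (≈-trans (≈-sym e) (∙-ψ c B′)))) v)
        (<⇒≱ s<s)

  -- The neighbotope as a polytope, and its faces in generic directions.

  ψArborescence : Pred (ℝ^ d) 0ℓ
  ψArborescence x = ∃[ B ] IsArborescence P B × x ≋ ψ P η B

  EnumeratedArborescence : Pred (Fin (length (vertices P) ℕ.^ length (vertices P))) 0ℓ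
  EnumeratedArborescence k = IsArborescence P (finToFun k)

  abstract
    -- Maps V P → V P are enumerated, up to pointwise equality, by finToFun.
    Γ : Polytope d
    Γ = hull (map (λ k → ψ P η (finToFun k)) (filter {P = EnumeratedArborescence} (λ _ → em) (allFin _)))

    ∈Γ⇒ : ∀ {x} → x ∈ₗ points Γ → ψArborescence x
    ∈Γ⇒ x∈ =
      let k , _ , x≋ , arb = Membership.∈-map∘filter⁻ (≡.setoid _) (≋-setoid d)
            {P = EnumeratedArborescence} (λ _ → em) (λ { refl arb → arb }) {xs = allFin _} x∈
      in finToFun k , arb , x≋

    ⇒∈Γ : ∀ {x} → ψArborescence x → x ∈ₗ points Γ
    ⇒∈Γ (B , arb , x≋) = Membership.∈-map∘filter⁺ (≡.setoid _) (≋-setoid d)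
      {P = EnumeratedArborescence} (λ _ → em) (λ { refl arb → arb }) {xs = allFin _} (λ { refl → ≋-refl })
      (funToFin B , ∈-allFin _ , ≋-trans x≋ (ψ-cong B≗) , IsArborescence-resp B≗ arb)
      where
      B≗ : B ≗ finToFun (funToFin B)
      B≗ v = ≡.sym (finToFun-funToFin B v)

  Γ≐neighbotope : ⟦ Γ ⟧ ≐ neighbotope P η
  Γ≐neighbotope = Conv-mono (λ {x} → ∈Γ⇒ {x}) , Conv-mono (λ {x} → ⇒∈Γ {x})

  module _ {c : ℝ^ d} (generic : Generic P η c) (v₀ : V P) where

    face-Γ : face ⟦ Γ ⟧ c ≐ (_≋ ψ P η (pivot P η c generic))
    face-Γ = face-singleton c _ (⇒∈Γ (_ , pivot-arborescence generic v₀ , ≋-refl))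
      (λ x∈ → let B , arb , x≋ = ∈Γ⇒ x∈ in
        ≤-respˡ-≈ (∙-congʳ c (≋-sym x≋)) (ψ-≤-pivot generic B (arborescence-step arb)))
      (λ x∈ e → let B , arb , x≋ = ∈Γ⇒ x∈ in
        ≋-trans x≋ (ψ-cong (ψ-≈-pivot⇒≗ generic B (arborescence-step arb) (≈-trans (∙-congʳ c (≋-sym x≋)) e))))

  module _ {c c′ : ℝ^ d} (g : Generic P η c) (g′ : Generic P η c′) where

    ≗⇒face⊆ : pivot P η c g ≗ pivot P η c′ g′ → ∀ {x} → x ∈ face ⟦ Γ ⟧ c → x ∈ face ⟦ Γ ⟧ c′
    ≗⇒face⊆ B≗B′ x∈ =
      -- No vertex of `P` is given here. A point of the face yields a spanning point of `Γ`, hence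
      -- an arborescence, whose root serves as the vertex.
      let p , p∈ = Conv-nonempty {S = _∈ₗ points Γ} (proj₁ x∈)
          B , arb , _ = ∈Γ⇒ p∈
          v₀ = IsArborescence.root arb
      in proj₂ (face-Γ g′ v₀) (≋-trans (proj₁ (face-Γ g v₀) x∈) (ψ-cong B≗B′))

    -- Both faces are single points, so the two images under `ψ` agree. The map `B` then attains the
    -- maximum of `c′`, which only the pivot map of `c′` does. The vertex `v` at which the maps are
    -- compared also supplies the start of the climb.
    face≐⇒≗ : face ⟦ Γ ⟧ c ≐ face ⟦ Γ ⟧ c′ → pivot P η c g ≗ pivot P η c′ g′
    face≐⇒≗ (c⊆c′ , _) v = ψ-≈-pivot⇒≗ g′ B (arborescence-step (pivot-arborescence g v)) (∙-congʳ c′ ψB≋) v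
      where
      B : V P → V P
      B = pivot P η c g
      ψB≋ : ψ P η B ≋ ψ P η (pivot P η c′ g′)
      ψB≋ = proj₁ (face-Γ g′ v) (c⊆c′ (proj₂ (face-Γ g v) ≋-refl))

  ≗⇒face≐ : ∀ {c c′} (g : Generic P η c) (g′ : Generic P η c′) →
            pivot P η c g ≗ pivot P η c′ g′ → face ⟦ Γ ⟧ c ≐ face ⟦ Γ ⟧ c′
  ≗⇒face≐ g g′ B≗B′ = ≗⇒face⊆ g g′ B≗B′ , ≗⇒face⊆ g′ g (λ v → ≡.sym (B≗B′ v))

theorem1p5 : (em : ExcludedMiddle 0ℓ) (ℝ : Reals) → let open Polytopes em ℝ in
    (d : ℕ) (P : Polytope d) (η : ℝ^ d → Carrier) → IsNormalization P η →
    Σ[ Γ ∈ Polytope d ] (⟦ Γ ⟧ ≐ neighbotope P η) ×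
    ((c c′ : ℝ^ d) (g : Generic P η c) (g′ : Generic P η c′) →
    (pivot P η c g ≗ pivot P η c′ g′) ⇔ (face ⟦ Γ ⟧ c ≐ face ⟦ Γ ⟧ c′))
theorem1p5 em ℝ d P η η-normalization =
  Γ , Γ≐neighbotope , λ c c′ g g′ → mk⇔ (≗⇒face≐ g g′) (face≐⇒≗ g g′)
  where open Neighbotopes em ℝ P η η-normalization
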